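{- Let $\Sigma$ be a finite alphabet of size $\sigma \ge 2$, let $n\ge 1$, and let $S\in \Sigma^n$ be a string chosen uniformly at random. Let $L(S)$ denote the maximum length of an unbordered factor of $S$. Then: (a) $\mathbb{E}[L(S)] = n - O(\sigma^{ -1})$; (b) for each $\delta>0$, the probability that $L(S) = n - O(\log_\sigma \delta^{ -1})$ is at least $1-\delta$. Here the constants implied by the $O(\cdot)$ notation are independent of $n$, $\sigma$ and $\delta$.
   Context: A string $S\in\Sigma^n$ is a sequence $S[1]\cdots S[n]$ of symbols from $\Sigma$; for $1\le i\le j\le n$, the factor $S[i,j]$ is $S[i]S[i+1]\cdots S[j]$. A border of a string $S$ of length $n$ is a non-empty prefix of $S$ that is also a suffix of $S$, i.e., $S$ has a border of length $\ell$ ($1\le \ell\le n$) iff $S[1,\ell]=S[n-\ell+1,n]$. A string is unbordered if it has no border other than the whole string. $L(S)$ is the maximum length of a factor of $S$ that is unbordered. -}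

module Defs where

open import Data.Nat using (ℕ; zero; suc; _+_; _*_; _∸_; _^_; _≤_; _<_; _⊔_; s≤s; z≤n)
import Data.Nat.Properties as ℕP
open import Data.Fin using (Fin)
import Data.Fin.Properties as FinP
open import Data.List using (List; []; _∷_; length; take; drop; map; concatMap; foldr; filter; allFin)
import Data.List.Properties as ListP
open import Data.Nat.ListAction using (sum)
open import Data.Product using (_×_; _,_)
open import Data.Sum using (inj₁; inj₂)
open import Relation.Nullary using (¬_; Dec; yes; no)
open import Relation.Binary.PropositionalEquality using (_≡_; _≢_; refl)
open import Data.Integer using (+_)
open import Data.Rational using (ℚ; 1ℚ; _/_) renaming (_*_ to _*ℚ_)

Word : ℕ → Set
Word σ = List (Fin σ)

-- The factor S[i,j] = S[i] S[i+1] ⋯ S[j] (1-based indices, 1 ≤ i ≤ j ≤ |S|).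
factor : ∀ {σ} → Word σ → ℕ → ℕ → Word σ
factor S i j = take (suc (j ∸ i)) (drop (i ∸ 1) S)

HasBorderOfLength : ∀ {σ} → Word σ → ℕ → Set
HasBorderOfLength w ℓ = (1 ≤ ℓ) × (ℓ ≤ length w) × (take ℓ w ≡ drop (length w ∸ ℓ) w)

NoBorderBelow : ∀ {σ} → Word σ → ℕ → Set
NoBorderBelow w m = ∀ ℓ → ℓ < m → ¬ HasBorderOfLength w ℓ

Unbordered : ∀ {σ} → Word σ → Set
Unbordered w = NoBorderBelow w (length w)

hasBorderOfLength? : ∀ {σ} (w : Word σ) ℓ → Dec (HasBorderOfLength w ℓ)
hasBorderOfLength? w ℓ with 1 ℕP.≤? ℓ | ℓ ℕP.≤? length w | ListP.≡-dec FinP._≟_ (take ℓ w) (drop (length w ∸ ℓ) w)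
... | yes a | yes b | yes c = yes (a , b , c)
... | no ¬a | _ | _ = no (λ { (a , _ , _) → ¬a a })
... | yes _ | no ¬b | _ = no (λ { (_ , b , _) → ¬b b })
... | yes _ | yes _ | no ¬c = no (λ { (_ , _ , c) → ¬c c })

noBorderBelow? : ∀ {σ} (w : Word σ) m → Dec (NoBorderBelow w m)
noBorderBelow? w zero = yes (λ ℓ ())
noBorderBelow? w (suc m) with noBorderBelow? w m | hasBorderOfLength? w m
... | no ¬p | _ = no (λ q → ¬p (λ ℓ lt → q ℓ (ℕP.m≤n⇒m≤1+n lt)))
... | yes _ | yes h = no (λ q → q m ℕP.≤-refl h)
... | yes p | no ¬h = yes f
  where
  f : NoBorderBelow w (suc m)
  f ℓ (s≤s le) with ℕP.m≤n⇒m<n∨m≡n le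
  ... | inj₁ lt = p ℓ lt
  ... | inj₂ refl = ¬h

unbordered? : ∀ {σ} (w : Word σ) → Dec (Unbordered w)
unbordered? w = noBorderBelow? w (length w)

range : ℕ → ℕ → List ℕ
range a zero = []
range a (suc k) = a ∷ range (suc a) k

factorPositions : ℕ → List (ℕ × ℕ)
factorPositions n = concatMap (λ i → map (λ j → i , j) (range i (suc (n ∸ i)))) (range 1 n)

-- L(S) = maximum length of an unbordered factor S[i,j] of S (0 if S is empty)
L : ∀ {σ} → Word σ → ℕ
L S = foldr _⊔_ 0 (map score (factorPositions (length S)))
  where
  score : ℕ × ℕ → ℕ
  score (i , j) with unbordered? (factor S i j)
  ... | yes _ = length (factor S i j)
  ... | no _ = 0

-- All strings of length n over Fin σ, each listed exactly once
-- (the sample space of the uniform distribution on Σⁿ).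
allWords : (σ n : ℕ) → List (Word σ)
allWords σ zero = [] ∷ []
allWords σ (suc n) = concatMap (λ w → map (_∷ w) (allFin σ)) (allWords σ n)

-- Σ_{S ∈ Σⁿ} L(S)   (so 𝔼[L(S)] = totalL σ n / σⁿ)
totalL : ℕ → ℕ → ℕ
totalL σ n = sum (map L (allWords σ n))

ℕ→ℚ : ℕ → ℚ
ℕ→ℚ k = (+ k) / 1

_^ℚ_ : ℚ → ℕ → ℚ
q ^ℚ zero = 1ℚ
q ^ℚ suc k = q *ℚ (q ^ℚ k)

-- #{ S ∈ Σⁿ : n − L(S) ≤ C · log_σ(1/δ) },  the inequality being written
-- (for δ > 0) in the equivalent exponentiated form  δ^C · σ^(n − L(S)) ≤ 1.
goodCount : (C σ n : ℕ) → ℚ → ℕ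
goodCount C σ n δ =
  length (filter (λ S → Data.Rational.Properties._≤?_ ((δ ^ℚ C) *ℚ ℕ→ℚ (σ ^ (n ∸ L S))) 1ℚ) (allWords σ n))
  where import Data.Rational.Properties

{-# OPTIONS --safe #-}

-- Let w be a word all of whose prefixes obtained by removing fewer than k final letters are bordered.  Its shortest
-- border has some length ℓ ≤ |w|/2, so w is recovered from ℓ and from the prefix s of length |w| − ℓ, which has the
-- same property (Bad below) with k − ℓ in place of k.  Counting along this recursion bounds the proportion of such words by
-- (2/σ)^k, and hence Pr[n − L(S) ≥ k] ≤ (2/σ)^k, which suffices for σ ≥ 3.
-- For σ = 2 the bound is improved for words starting with a doubled letter aa, since then the shortest border cannot
-- have length 2: the proportion becomes O((9/10)^k).  A binary word not starting with a doubled letter is determined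
-- by all letters but the first, so removing letters at the front reaches a doubled letter except with exponentially small probability.
-- Summing over k gives (a).  For (b) Pr[n − L(S) ≥ m] must be at most σ^(−m/C) for every m ≥ 1; small m are covered by
-- Pr[n − L(S) ≥ 1] ≤ 7/8.
module Submission where

open import Defs
open import Algebra.Bundles using (CommutativeRing)
import Algebra.Properties.CommutativeSemigroup as CommutativeSemigroupProperties
open import Data.Empty using (⊥-elim)
open import Data.Fin using (Fin; opposite) renaming (zero to 0F; suc to sucF)
import Data.Fin.Properties as Fin
import Data.Integer as ℤ
import Data.Integer.Properties as ℤ
open import Data.List using (List; []; _∷_; _++_; length; map; concatMap; filter; allFin; take; drop; foldr)
open import Data.List.Membership.Propositional using (_∈_)
open import Data.List.Membership.Propositional.Properties
open import Data.List.Properties using (length-++; length-map; length-tabulate; length-take; length-drop; ∷-injective;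
  take-take; take-drop; take-all; take++drop≡id; drop-drop; drop-[]; filter-++; filter-accept)
open import Data.List.Relation.Unary.All as All using (All)
import Data.List.Relation.Unary.All.Properties as All
import Data.List.Relation.Unary.AllPairs as AllPairs
import Data.List.Relation.Unary.AllPairs.Properties as AllPairs
open import Data.List.Relation.Unary.Any using (here; there)
open import Data.List.Relation.Unary.Unique.Propositional using (Unique; _∷_)
import Data.List.Relation.Unary.Unique.Propositional.Properties as Unique
open import Data.Nat using (ℕ; zero; suc; _+_; _*_; _∸_; _^_; _≤_; _<_; _⊔_; _⊓_; z≤n; s≤s; NonZero; >-nonZero)
open import Data.Nat.Induction using (<-rec)
open import Data.Nat.ListAction using (sum)
open import Data.Nat.Properties
open import Data.Nat.Tactic.RingSolver using (solve-∀)
open import Data.Product using (_×_; _,_; ∃; proj₁; proj₂)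
open import Data.Rational using (ℚ; 0ℚ; 1ℚ; _-_) renaming (_*_ to _*ℚ_; _≤_ to _≤ℚ_; _<_ to _<ℚ_)
import Data.Rational as ℚ
import Data.Rational.Properties as ℚ
open import Data.Rational.Unnormalised as ℚᵘ using (mkℚᵘ; *≡*; *≤*)
import Data.Rational.Unnormalised.Properties as ℚᵘ
open import Data.Sum using (_⊎_; inj₁; inj₂; [_,_]′)
open import Data.Unit using (⊤; tt)
open import Level using (0ℓ)
open import Relation.Binary.PropositionalEquality
open import Relation.Nullary using (¬_; yes; no)
open import Relation.Unary using (Pred; Decidable)

open CommutativeSemigroupProperties *-commutativeSemigroup
  renaming (x∙yz≈y∙xz to *-swap; interchange to *-interchange) using ()
open CommutativeSemigroupProperties +-commutativeSemigroup
  renaming (interchange to +-interchange) using ()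

private variable
  A : Set
  σ N c d : ℕ

-- Counting words by covering lists

sumBelow : (ℕ → ℕ) → ℕ → ℕ
sumBelow f zero = 0
sumBelow f (suc n) = sumBelow f n + f n

-- Deleting one occurrence of `x` from `ys` still leaves every element of the remaining `xs`,
-- because `x` does not recur among them.
unique-⊆-length : {xs ys : List A} → Unique xs → (∀ {x} → x ∈ xs → x ∈ ys) → length xs ≤ length ys
unique-⊆-length {xs = []} _ _ = z≤n
unique-⊆-length {xs = x ∷ xs} (x∉xs ∷ u) xs⊆ys with ∈-∃++ (xs⊆ys (here refl))
... | as , bs , refl = begin
  suc (length xs)          ≤⟨ s≤s (unique-⊆-length u xs⊆as++bs) ⟩
  suc (length (as ++ bs))  ≡⟨ cong suc (length-++ as) ⟩
  suc (length as + length bs) ≡⟨ +-suc (length as) (length bs) ⟨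
  length as + suc (length bs) ≡⟨ length-++ as ⟨
  length (as ++ x ∷ bs)    ∎
  where
  open ≤-Reasoning
  xs⊆as++bs : ∀ {y} → y ∈ xs → y ∈ as ++ bs
  xs⊆as++bs y∈xs with ∈-++⁻ as (xs⊆ys (there y∈xs))
  ... | inj₁ y∈as = ∈-++⁺ˡ y∈as
  ... | inj₂ (here refl) = ⊥-elim (All.lookup x∉xs y∈xs refl)
  ... | inj₂ (there y∈bs) = ∈-++⁺ʳ as y∈bs

allWords-length : (σ n : ℕ) → length (allWords σ n) ≡ σ ^ n
allWords-length σ zero = refl
allWords-length σ (suc n) =
  trans (extensions (allWords σ n)) (cong (σ *_) (allWords-length σ n))
  where
  open ≡-Reasoning
  extensions : ∀ ws → length (concatMap (λ w → map (_∷ w) (allFin σ)) ws) ≡ σ * length ws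
  extensions [] = sym (*-zeroʳ σ)
  extensions (w ∷ ws) = begin
    length (map (_∷ w) (allFin σ) ++ rest) ≡⟨ length-++ (map (_∷ w) (allFin σ)) ⟩
    length (map (_∷ w) (allFin σ)) + length rest
      ≡⟨ cong₂ _+_ (trans (length-map (_∷ w) (allFin σ)) (length-tabulate {n = σ} (λ i → i))) (extensions ws) ⟩
    σ + σ * length ws ≡⟨ *-suc σ (length ws) ⟨
    σ * suc (length ws) ∎
    where rest = concatMap (λ w → map (_∷ w) (allFin σ)) ws

allWords-complete : (w : Word σ) → w ∈ allWords σ (length w)
allWords-complete [] = here refl
allWords-complete (a ∷ w) =
  ∈-concat⁺′ (∈-map⁺ (_∷ w) (∈-allFin a)) (∈-map⁺ _ (allWords-complete w))

allWords-sound : ∀ n {w : Word σ} → w ∈ allWords σ n → length w ≡ n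
allWords-sound zero (here refl) = refl
allWords-sound {σ} (suc n) w∈ with ∈-concat⁻′ (map (λ w → map (_∷ w) (allFin σ)) (allWords σ n)) w∈
... | _ , w∈vs , vs∈ with ∈-map⁻ (λ w → map (_∷ w) (allFin σ)) vs∈
... | v , v∈ , refl with ∈-map⁻ (_∷ v) w∈vs
... | _ , _ , refl = cong suc (allWords-sound n v∈)

allWords-unique : (σ n : ℕ) → Unique (allWords σ n)
allWords-unique σ zero = All.[] AllPairs.∷ AllPairs.[]
allWords-unique σ (suc n) = Unique.concat⁺
  (All.map⁺ (All.tabulate λ _ → Unique.map⁺ (λ eq → proj₁ (∷-injective eq)) (Unique.allFin⁺ σ)))
  (AllPairs.map⁺ (AllPairs.map disjoint (allWords-unique σ n)))
  where
  disjoint : {v w : Word σ} → v ≢ w → ∀ {x} →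
    ¬ (x ∈ map (_∷ v) (allFin σ) × x ∈ map (_∷ w) (allFin σ))
  disjoint {v} {w} v≢w (x∈v , x∈w) with ∈-map⁻ (_∷ v) x∈v | ∈-map⁻ (_∷ w) x∈w
  ... | _ , _ , refl | _ , _ , eq = v≢w (proj₂ (∷-injective eq))

-- P need not be decidable, so “at most c words of length N satisfy P” is witnessed by a list containing them.
Cover : ∀ {σ} → Pred (Word σ) 0ℓ → ℕ → ℕ → Set
Cover {σ} P N c = ∃ λ (ys : List (Word σ)) → length ys ≤ c × (∀ w → length w ≡ N → P w → w ∈ ys)

module _ {P : Pred (Word σ) 0ℓ} where

  cover-all : Cover P N (σ ^ N)
  cover-all {N} = allWords σ N , ≤-reflexive (allWords-length σ N) ,
    λ { w refl _ → allWords-complete w }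

  cover-none : (∀ w → length w ≡ N → ¬ P w) → Cover P N c
  cover-none none = [] , z≤n , λ w eq p → ⊥-elim (none w eq p)

  cover-weaken : c ≤ d → Cover P N c → Cover P N d
  cover-weaken c≤d (ys , len , all) = ys , ≤-trans len c≤d , all

  cover-count : (P? : Decidable P) → Cover P N c → length (filter P? (allWords σ N)) ≤ c
  cover-count {N} P? (ys , len , all) = ≤-trans
    (unique-⊆-length (Unique.filter⁺ P? (allWords-unique σ N))
      (λ x∈ → let x∈ws , px = ∈-filter⁻ P? {xs = allWords σ N} x∈ in all _ (allWords-sound N x∈ws) px))
    len

module _ {P Q : Pred (Word σ) 0ℓ} where

  cover-⊆ : (∀ w → length w ≡ N → P w → Q w) → Cover Q N c → Cover P N c
  cover-⊆ P⊆Q (ys , len , all) = ys , len , λ w eq p → all w eq (P⊆Q w eq p)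

  cover-⊎ : Cover P N c → Cover Q N d → Cover (λ w → P w ⊎ Q w) N (c + d)
  cover-⊎ (xs , lx , px) (ys , ly , py) =
    xs ++ ys , ≤-trans (≤-reflexive (length-++ xs)) (+-mono-≤ lx ly) , λ where
      w eq (inj₁ p) → ∈-++⁺ˡ (px w eq p)
      w eq (inj₂ q) → ∈-++⁺ʳ xs (py w eq q)

-- Words that `f` restores from a family cannot outnumber that family. In later uses `s` is what is
-- left of `w` after a border or a first letter has been removed.
cover-image : {P : Pred (Word σ) 0ℓ} {M : ℕ} (f : Word σ → Word σ) → Cover P M c →
  Cover (λ w → ∃ λ s → length s ≡ M × P s × w ≡ f s) N c
cover-image f (ys , len , all) =
  map f ys , ≤-trans (≤-reflexive (length-map f ys)) len ,
  λ { w _ (s , eq , p , refl) → ∈-map⁺ f (all s eq p) }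

cover-∃< : {P : ℕ → Pred (Word σ) 0ℓ} {f : ℕ → ℕ} (m : ℕ) → (∀ j → j < m → Cover (P j) N (f j)) →
  Cover (λ w → ∃ λ j → j < m × P j w) N (sumBelow f m)
cover-∃< zero _ = cover-none λ { _ _ (_ , () , _) }
cover-∃< {P = P} (suc m) covers = cover-⊆ split
  (cover-⊎ (cover-∃< m (λ j j<m → covers j (m<n⇒m<1+n j<m))) (covers m ≤-refl))
  where
  split : ∀ w → _ → (∃ λ j → j < suc m × P j w) → (∃ λ j → j < m × P j w) ⊎ P m w
  split w _ (j , s≤s j≤m , p) with m≤n⇒m<n∨m≡n j≤m
  ... | inj₁ j<m = inj₁ (j , j<m , p)
  ... | inj₂ refl = inj₂ p

-- Shortest borders

-- The field `half` rules out the trivial border `w` itself and keeps the prefix and suffix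
-- occurrences of the border disjoint.
record ShortestBorder {σ} (w : Word σ) (ℓ : ℕ) : Set where
  field
    border : HasBorderOfLength w ℓ
    minimal : NoBorderBelow w ℓ
    half : ℓ + ℓ ≤ length w

open ShortestBorder

least-border : (w : Word σ) (m : ℕ) → ¬ NoBorderBelow w m →
  ∃ λ ℓ → ℓ < m × HasBorderOfLength w ℓ × NoBorderBelow w ℓ
least-border w zero some = ⊥-elim (some λ _ ())
least-border w (suc m) some with noBorderBelow? w m
... | no some′ with least-border w m some′
...   | ℓ , ℓ<m , p = ℓ , m<n⇒m<1+n ℓ<m , p
least-border w (suc m) some | yes none with hasBorderOfLength? w m
...   | yes b = m , ≤-refl , b , none
...   | no ¬b = ⊥-elim (some none′)
  where
  none′ : NoBorderBelow w (suc m)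
  none′ ℓ (s≤s ℓ≤m) with m≤n⇒m<n∨m≡n ℓ≤m
  ... | inj₁ ℓ<m = none ℓ ℓ<m
  ... | inj₂ refl = ¬b

take-take-≤ : ∀ {A : Set} {m n} (xs : List A) → m ≤ n → take m (take n xs) ≡ take m xs
take-take-≤ {m = m} {n} xs m≤n = trans (take-take m n xs) (cong (λ z → take z xs) (m≤n⇒m⊓n≡m m≤n))

-- Two overlapping occurrences of a border share a factor of length 2ℓ − |w|, which is again a border.
overlap-border : (w : Word σ) (ℓ : ℕ) → ℓ < length w → length w < ℓ + ℓ → HasBorderOfLength w ℓ →
  ∃ λ o → o < ℓ × HasBorderOfLength w o
overlap-border w ℓ ℓ<n n<2ℓ (1≤ℓ , ℓ≤n , eq) =
  o , o<ℓ , m<n⇒0<n∸m p<ℓ , ≤-trans (<⇒≤ o<ℓ) ℓ≤n , coincide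
  where
  open ≡-Reasoning
  n = length w
  p = n ∸ ℓ
  o = ℓ ∸ p
  p<ℓ : p < ℓ
  p<ℓ = ≤-trans (∸-monoˡ-< n<2ℓ ℓ≤n) (≤-reflexive (m+n∸n≡m ℓ ℓ))
  p+o≡ℓ : p + o ≡ ℓ
  p+o≡ℓ = m+[n∸m]≡n (<⇒≤ p<ℓ)
  o<ℓ : o < ℓ
  o<ℓ = ∸-monoʳ-< (m<n⇒0<n∸m ℓ<n) (<⇒≤ p<ℓ)
  p+p≡n∸o : p + p ≡ n ∸ o
  p+p≡n∸o = begin
    p + p ≡⟨ cong (_+ p) (m+n∸n≡m p o) ⟨
    (p + o ∸ o) + p ≡⟨ cong (λ z → z ∸ o + p) p+o≡ℓ ⟩
    (ℓ ∸ o) + p ≡⟨ +-comm (ℓ ∸ o) p ⟩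
    p + (ℓ ∸ o) ≡⟨ +-∸-assoc p (<⇒≤ o<ℓ) ⟨
    (p + ℓ) ∸ o ≡⟨ cong (_∸ o) (m∸n+n≡m ℓ≤n) ⟩
    n ∸ o ∎
  coincide : take o w ≡ drop (n ∸ o) w
  coincide = begin
    take o w ≡⟨ take-take-≤ w (<⇒≤ o<ℓ) ⟨
    take o (take ℓ w) ≡⟨ cong (take o) eq ⟩
    take o (drop p w) ≡⟨ take-drop o p w ⟩
    drop p (take (p + o) w) ≡⟨ cong (λ z → drop p (take z w)) p+o≡ℓ ⟩
    drop p (take ℓ w) ≡⟨ cong (drop p) eq ⟩
    drop p (drop p w) ≡⟨ drop-drop p p w ⟩
    drop (p + p) w ≡⟨ cong (λ z → drop z w) p+p≡n∸o ⟩
    drop (n ∸ o) w ∎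

-- A least proper border longer than half the word would overlap itself and so yield a shorter one.
shortest-border : (w : Word σ) → ¬ Unbordered w → ∃ (ShortestBorder w)
shortest-border w bordered with least-border w (length w) bordered
... | ℓ , ℓ<n , b , none = ℓ , record { border = b ; minimal = none ; half = ≮⇒≥ not-long }
  where
  not-long : ¬ (length w < ℓ + ℓ)
  not-long n<2ℓ with overlap-border w ℓ ℓ<n n<2ℓ b
  ... | o , o<ℓ , b′ = none o o<ℓ b′

-- Bad words and the recursion for their number

extend : ∀ {σ} → ℕ → Word σ → Word σ
extend ℓ s = s ++ take ℓ s

chop : ∀ {σ} → ℕ → Word σ → Word σ
chop ℓ w = take (length w ∸ ℓ) w

Bad : ∀ {σ} → ℕ → Word σ → Set
Bad k w = ∀ i → i < k → ¬ Unbordered (chop i w)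

length-chop : ∀ ℓ (w : Word σ) → length (chop ℓ w) ≡ length w ∸ ℓ
length-chop ℓ w = trans (length-take _ w) (m≤n⇒m⊓n≡m (m∸n≤m _ ℓ))

chop-chop : ∀ ℓ i (w : Word σ) → chop i (chop ℓ w) ≡ chop (ℓ + i) w
chop-chop ℓ i w rewrite length-chop ℓ w | ∸-+-assoc (length w) ℓ i =
  take-take-≤ w (∸-monoʳ-≤ (length w) (m≤m+n ℓ i))

-- By `half` the first occurrence of the border lies inside `chop ℓ w`, so the deleted suffix can be
-- copied from there.
extend-chop : ∀ {ℓ} {w : Word σ} → ShortestBorder w ℓ → w ≡ extend ℓ (chop ℓ w)
extend-chop {ℓ = ℓ} {w} sb = begin
  w ≡⟨ take++drop≡id (length w ∸ ℓ) w ⟨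
  chop ℓ w ++ drop (length w ∸ ℓ) w ≡⟨ cong (chop ℓ w ++_) (proj₂ (proj₂ (border sb))) ⟨
  chop ℓ w ++ take ℓ w ≡⟨ cong (chop ℓ w ++_) (take-take-≤ w ℓ≤) ⟨
  chop ℓ w ++ take ℓ (chop ℓ w) ∎
  where
  open ≡-Reasoning
  ℓ≤ : ℓ ≤ length w ∸ ℓ
  ℓ≤ = ≤-trans (≤-reflexive (sym (m+n∸n≡m ℓ ℓ))) (∸-monoˡ-≤ ℓ (half sb))

bad-chop : ∀ ℓ j (w : Word σ) → Bad (ℓ + j) w → Bad j (chop ℓ w)
bad-chop ℓ j w bad i i<j = subst (λ v → ¬ Unbordered v) (sym (chop-chop ℓ i w)) (bad (ℓ + i) (+-monoʳ-< ℓ i<j))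

sumBelow-*ʳ : ∀ f c n → sumBelow (λ j → f j * c) n ≡ sumBelow f n * c
sumBelow-*ʳ f c zero = refl
sumBelow-*ʳ f c (suc n) rewrite sumBelow-*ʳ f c n = sym (*-distribʳ-+ c (sumBelow f n) (f n))

-- In `cover-bad` this pays for all shortest borders longer than `k` at once: what they leave is
-- shorter than `M`, at the cost of a single `σ ^ M`, the leading 1 in `g-step`.
sumBelow-^ : ∀ {σ} → 2 ≤ σ → ∀ M → sumBelow (σ ^_) M ≤ σ ^ M
sumBelow-^ 2≤σ zero = z≤n
sumBelow-^ {σ} 2≤σ (suc M) = begin
  sumBelow (σ ^_) M + σ ^ M ≤⟨ +-monoˡ-≤ (σ ^ M) (sumBelow-^ 2≤σ M) ⟩
  σ ^ M + σ ^ M ≡⟨ cong (σ ^ M +_) (+-identityʳ _) ⟨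
  2 * σ ^ M ≤⟨ *-monoˡ-≤ (σ ^ M) 2≤σ ⟩
  σ ^ suc M ∎
  where open ≤-Reasoning

-- The indicator e marks the admissible lengths of a shortest border.
cover-indicator : {P : Pred (Word σ) 0ℓ} (e : ℕ) → Cover P N c → Cover (λ w → e ≡ 1 × P w) N (e * c)
cover-indicator zero _ = cover-none λ { _ _ (() , _) }
cover-indicator (suc e) cov = cover-weaken (m≤m+n _ _) (cover-⊆ (λ _ _ → proj₂) cov)

-- If the shortest border has length ℓ ≤ k then w is determined by ℓ and by chop ℓ w, which is bad for k − ℓ;
-- if ℓ > k, chop ℓ w is an arbitrary word shorter than M.
module _ (2≤σ : 2 ≤ σ) (Q : Pred (Word σ) 0ℓ) (Q-take : ∀ i w → Q w → Q (take i w))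
  (e g : ℕ → ℕ) (e-admissible : ∀ w ℓ → Q w → ShortestBorder w ℓ → e ℓ ≡ 1)
  (g-step : ∀ k → 1 + sumBelow (λ j → e (k ∸ j) * g j) k ≤ g k) where

  cover-bad : ∀ k M → Cover (λ w → Bad k w × Q w) (k + M) (g k * σ ^ M)
  cover-bad = <-rec (λ k → ∀ M → Cover (λ w → Bad k w × Q w) (k + M) (g k * σ ^ M)) step
    where
    step : ∀ k → (∀ {j} → j < k → ∀ M → Cover (λ w → Bad j w × Q w) (j + M) (g j * σ ^ M)) →
      ∀ M → Cover (λ w → Bad k w × Q w) (k + M) (g k * σ ^ M)
    -- Every word is `Bad 0`, and `g-step 0` says `1 ≤ g 0`.
    step zero _ M = cover-weaken
      (≤-trans (≤-reflexive (sym (*-identityˡ _))) (*-monoˡ-≤ (σ ^ M) (g-step 0))) cover-all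
    -- A remainder of length `r < M` belongs to a border of length `k + M ∸ r`, which exceeds `k`;
    -- an index `j < k` belongs to a border of length `k ∸ j`.
    step k@(suc _) rec M = cover-weaken total (cover-⊆ split (cover-⊎
      (cover-∃< M λ r _ → cover-image {P = λ _ → ⊤} (extend (k + M ∸ r)) cover-all)
      (cover-∃< k λ j j<k → cover-indicator (e (k ∸ j)) (cover-image (extend (k ∸ j)) (rec j<k M)))))
      where
      open ≤-Reasoning
      total : sumBelow (σ ^_) M + sumBelow (λ j → e (k ∸ j) * (g j * σ ^ M)) k ≤ g k * σ ^ M
      total = begin
        sumBelow (σ ^_) M + sumBelow (λ j → e (k ∸ j) * (g j * σ ^ M)) k
          ≤⟨ +-mono-≤ (sumBelow-^ 2≤σ M) (≤-reflexive (regroup k)) ⟩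
        σ ^ M + sumBelow (λ j → e (k ∸ j) * g j * σ ^ M) k
          ≡⟨ cong (σ ^ M +_) (sumBelow-*ʳ (λ j → e (k ∸ j) * g j) (σ ^ M) k) ⟩
        (1 + sumBelow (λ j → e (k ∸ j) * g j) k) * σ ^ M ≤⟨ *-monoˡ-≤ (σ ^ M) (g-step k) ⟩
        g k * σ ^ M ∎
        where
        regroup : ∀ m → sumBelow (λ j → e (k ∸ j) * (g j * σ ^ M)) m ≡ sumBelow (λ j → e (k ∸ j) * g j * σ ^ M) m
        regroup zero = refl
        regroup (suc m) = cong₂ _+_ (regroup m) (sym (*-assoc (e (k ∸ m)) (g m) (σ ^ M)))
      split : ∀ w → length w ≡ k + M → Bad k w × Q w →
        (∃ λ r → r < M × ∃ λ s → length s ≡ r × ⊤ × w ≡ extend (k + M ∸ r) s)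
        ⊎ (∃ λ j → j < k × e (k ∸ j) ≡ 1 ×
             ∃ λ s → length s ≡ j + M × (Bad j s × Q s) × w ≡ extend (k ∸ j) s)
      -- Since `k` is positive, badness at 0 removed letters says that `w` itself is bordered.
      split w n≡ (bad , q) with shortest-border w
        (subst (λ v → ¬ Unbordered v) (take-all (length w) w ≤-refl) (bad 0 (s≤s z≤n)))
      ... | ℓ , sb with k <? ℓ
      ... | yes k<ℓ = inj₁ (length s , s<M , s , refl , _ , trans (extend-chop sb) (cong (λ z → extend z s) ℓ≡))
        where
        s = chop ℓ w
        ℓ≤n : ℓ ≤ length w
        ℓ≤n = proj₁ (proj₂ (border sb))
        s<M : length s < M
        s<M = begin-strict
          length s ≡⟨ length-chop ℓ w ⟩
          length w ∸ ℓ <⟨ ∸-monoʳ-< k<ℓ ℓ≤n ⟩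
          length w ∸ k ≡⟨ cong (_∸ k) n≡ ⟩
          k + M ∸ k ≡⟨ m+n∸m≡n k M ⟩
          M ∎
        ℓ≡ : ℓ ≡ k + M ∸ length s
        ℓ≡ = sym (trans (cong₂ _∸_ (sym n≡) (length-chop ℓ w)) (m∸[m∸n]≡n ℓ≤n))
      ... | no k≮ℓ = inj₂ (j , j<k , trans (cong e (sym ℓ≡)) (e-admissible w ℓ q sb) ,
            s , s-length , (bad-chop ℓ j w (subst (λ z → Bad z w) (sym ℓ+j≡k) bad) , Q-take _ w q) ,
            trans (extend-chop sb) (cong (λ z → extend z s) ℓ≡))
        where
        s = chop ℓ w
        j = k ∸ ℓ
        ℓ≤k : ℓ ≤ k
        ℓ≤k = ≮⇒≥ k≮ℓ
        j<k : j < k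
        j<k = ∸-monoʳ-< (proj₁ (border sb)) ℓ≤k
        ℓ≡ : ℓ ≡ k ∸ j
        ℓ≡ = sym (m∸[m∸n]≡n ℓ≤k)
        ℓ+j≡k : ℓ + j ≡ k
        ℓ+j≡k = m+[n∸m]≡n ℓ≤k
        s-length : length s ≡ j + M
        s-length = trans (length-chop ℓ w) (trans (cong (_∸ ℓ) n≡) (+-∸-comm M ℓ≤k))

-- Lower and upper bounds for L

∈-range : ∀ {a x} k → a ≤ x → x < a + k → x ∈ range a k
∈-range {a} zero a≤x x<a = ⊥-elim (<⇒≱ x<a (≤-trans (≤-reflexive (+-identityʳ a)) a≤x))
∈-range {a} {x} (suc k) a≤x x<a+k with m≤n⇒m<n∨m≡n a≤x
... | inj₁ a<x = there (∈-range k a<x (≤-trans x<a+k (≤-reflexive (+-suc a k))))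
... | inj₂ refl = here refl

≤-foldr-⊔ : ∀ {f : A → ℕ} {x xs} → x ∈ xs → f x ≤ foldr _⊔_ 0 (map f xs)
≤-foldr-⊔ {f = f} {xs = y ∷ ys} (here refl) = m≤m⊔n (f y) _
≤-foldr-⊔ {f = f} {xs = y ∷ ys} (there x∈) = ≤-trans (≤-foldr-⊔ x∈) (m≤n⊔m (f y) _)

foldr-⊔-≤ : ∀ {f : A → ℕ} {b} xs → (∀ x → f x ≤ b) → foldr _⊔_ 0 (map f xs) ≤ b
foldr-⊔-≤ [] f≤b = z≤n
foldr-⊔-≤ (x ∷ xs) f≤b = ⊔-lub (f≤b x) (foldr-⊔-≤ xs f≤b)

-- The scoring function is local to L and can only be named through unification.
factorScore : (S : Word σ) → ∃ λ f → L S ≡ foldr _⊔_ 0 (map f (factorPositions (length S)))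
factorScore S = _ , refl

L≤length : (S : Word σ) → L S ≤ length S
L≤length S = foldr-⊔-≤ (factorPositions (length S)) score≤
  where
  factor≤length : ∀ i j → length (factor S i j) ≤ length S
  factor≤length i j = begin
    length (factor S i j) ≡⟨ length-take (suc (j ∸ i)) (drop (i ∸ 1) S) ⟩
    suc (j ∸ i) ⊓ length (drop (i ∸ 1) S) ≤⟨ m⊓n≤n (suc (j ∸ i)) _ ⟩
    length (drop (i ∸ 1) S) ≡⟨ length-drop (i ∸ 1) S ⟩
    length S ∸ (i ∸ 1) ≤⟨ m∸n≤m (length S) (i ∸ 1) ⟩
    length S ∎
    where open ≤-Reasoning
  score≤ : ∀ ij → proj₁ (factorScore S) ij ≤ length S
  score≤ (i , j) with unbordered? (factor S i j)
  ... | yes _ = factor≤length i j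
  ... | no _ = z≤n

factor≤L : (S : Word σ) (i j : ℕ) → (i , j) ∈ factorPositions (length S) → Unbordered (factor S i j) →
  length (factor S i j) ≤ L S
factor≤L S i j ij∈ u = ≤-trans length≤score (≤-foldr-⊔ ij∈)
  where
  length≤score : length (factor S i j) ≤ proj₁ (factorScore S) (i , j)
  length≤score with unbordered? (factor S i j)
  ... | yes _ = ≤-refl
  ... | no ¬u = ⊥-elim (¬u u)

-- Here i = suc j and the right end is j + r, in the 1-based indexing of factors.
unbordered⇒≤L : (S : Word σ) (j r : ℕ) → j + r ≤ length S → Unbordered (take r (drop j S)) → r ≤ L S
unbordered⇒≤L S j zero _ _ = z≤n
unbordered⇒≤L S j (suc r) end≤n u = begin
  suc r ≡⟨ m≤n⇒m⊓n≡m r≤ ⟨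
  suc r ⊓ length (drop j S) ≡⟨ length-take (suc r) (drop j S) ⟨
  length (take (suc r) (drop j S)) ≡⟨ cong length factor≡ ⟨
  length (factor S (suc j) (suc j + r)) ≤⟨ factor≤L S (suc j) (suc j + r) position (subst Unbordered (sym factor≡) u) ⟩
  L S ∎
  where
  open ≤-Reasoning
  factor≡ : factor S (suc j) (suc j + r) ≡ take (suc r) (drop j S)
  factor≡ = cong (λ z → take (suc z) (drop j S)) (m+n∸m≡n j r)
  r≤ : suc r ≤ length (drop j S)
  r≤ = begin
    suc r ≡⟨ m+n∸m≡n j (suc r) ⟨
    j + suc r ∸ j ≤⟨ ∸-monoˡ-≤ j end≤n ⟩
    length S ∸ j ≡⟨ length-drop j S ⟨
    length (drop j S) ∎
  end≤n′ : suc j + r ≤ length S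
  end≤n′ = ≤-trans (≤-reflexive (sym (+-suc j r))) end≤n
  j<n : suc j ≤ length S
  j<n = ≤-trans (m≤m+n (suc j) r) end≤n′
  position : (suc j , suc j + r) ∈ factorPositions (length S)
  position = ∈-concat⁺′
    (∈-map⁺ (suc j ,_) (∈-range _ (m≤m+n (suc j) r) (begin-strict
      suc j + r ≤⟨ end≤n′ ⟩
      length S ≡⟨ m+[n∸m]≡n j<n ⟨
      suc j + (length S ∸ suc j) <⟨ +-monoʳ-< (suc j) (n<1+n _) ⟩
      suc j + suc (length S ∸ suc j) ∎)))
    (∈-map⁺ (λ i → map (i ,_) (range i (suc (length S ∸ i)))) (∈-range (length S) (s≤s z≤n) (s≤s j<n)))

defect : Word σ → ℕ
defect S = length S ∸ L S

-- Of the |S| − L(S) surplus letters, j can be removed at the front and i at the back.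
defect⇒bad : ∀ {t k} (S : Word σ) → t + k ≤ suc (defect S) → ∀ j → j < t → Bad k (drop j S)
defect⇒bad {t = t} {k} S t+k≤ j j<t i i<k u = <⇒≱ j+i<defect defect≤j+i
  where
  open ≤-Reasoning
  n = length S
  j+i<defect : j + i < defect S
  j+i<defect = ≤-pred (begin
    suc (suc (j + i)) ≡⟨ cong suc (+-suc j i) ⟨
    suc j + suc i ≤⟨ +-mono-≤ j<t i<k ⟩
    t + k ≤⟨ t+k≤ ⟩
    suc (defect S) ∎)
  j+i≤n : j + i ≤ n
  j+i≤n = ≤-trans (<⇒≤ j+i<defect) (m∸n≤m n (L S))
  fits : j + (n ∸ (j + i)) ≤ n
  fits = begin
    j + (n ∸ (j + i)) ≤⟨ +-monoʳ-≤ j (∸-monoʳ-≤ n (m≤m+n j i)) ⟩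
    j + (n ∸ j) ≡⟨ m+[n∸m]≡n (m+n≤o⇒m≤o j j+i≤n) ⟩
    n ∎
  u′ : Unbordered (take (n ∸ (j + i)) (drop j S))
  u′ = subst (λ r → Unbordered (take r (drop j S)))
    (trans (cong (_∸ i) (length-drop j S)) (∸-+-assoc n j i)) u
  defect≤j+i : defect S ≤ j + i
  defect≤j+i = begin
    n ∸ L S ≤⟨ ∸-monoʳ-≤ n (unbordered⇒≤L S j _ fits u′) ⟩
    n ∸ (n ∸ (j + i)) ≡⟨ m∸[m∸n]≡n j+i≤n ⟩
    j + i ∎

-- Covers of words without long unbordered factors

module _ (2≤σ : 2 ≤ σ) where

  cover-bad-power : ∀ k M → Cover {σ} (Bad k) (k + M) (2 ^ k * σ ^ M)
  cover-bad-power k M = cover-⊆ (λ _ _ bad → bad , tt)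
    (cover-bad 2≤σ (λ _ → ⊤) _ (λ _ → 1) (2 ^_) (λ _ _ _ _ → refl) geometric k M)
    where
    geometric : ∀ k → 1 + sumBelow (λ j → 1 * 2 ^ j) k ≤ 2 ^ k
    geometric zero = ≤-refl
    geometric (suc k) = +-mono-≤ (geometric k) ≤-refl

-- Binary words and doubled first letters

DoubledHead : Word σ → Set
DoubledHead w = ∀ {a b r} → w ≡ a ∷ b ∷ r → a ≡ b

-- Words of fewer than two letters satisfy `DoubledHead` vacuously, which makes the property closed
-- under prefixes, as `cover-bad` demands.
doubledHead-take : ∀ i (w : Word σ) → DoubledHead w → DoubledHead (take i w)
doubledHead-take (suc (suc i)) (a ∷ b ∷ r) dh refl = dh refl
doubledHead-take (suc zero) (a ∷ b ∷ r) dh ()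
doubledHead-take (suc (suc i)) (a ∷ []) dh ()
doubledHead-take (suc zero) (a ∷ []) dh ()

notTwo : ℕ → ℕ
notTwo 2 = 0
notTwo _ = 1

notTwo≤1 : ∀ ℓ → notTwo ℓ ≤ 1
notTwo≤1 0 = ≤-refl
notTwo≤1 1 = ≤-refl
notTwo≤1 2 = z≤n
notTwo≤1 (suc (suc (suc _))) = ≤-refl

-- A border `aa` ends the word in its own first letter, so `a` would be a shorter border.
doubledHead-border≢2 : (w : Word σ) → DoubledHead w → ¬ ShortestBorder w 2
doubledHead-border≢2 w@(a ∷ b ∷ r) dh sb with dh refl | proj₂ (proj₂ (border sb))
... | refl | eq = minimal sb 1 ≤-refl (≤-refl , s≤s z≤n , (begin
    a ∷ [] ≡⟨ cong (drop 1) eq ⟩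
    drop 1 (drop (length w ∸ 2) w) ≡⟨ drop-drop (length w ∸ 2) 1 w ⟩
    drop (length r + 1) w ≡⟨ cong (λ z → drop z w) (+-comm (length r) 1) ⟩
    drop (length w ∸ 1) w ∎))
  where open ≡-Reasoning
doubledHead-border≢2 [] dh sb with half sb
... | ()
doubledHead-border≢2 (a ∷ []) dh sb with half sb
... | s≤s ()

doubledHead-admissible : (w : Word σ) (ℓ : ℕ) → DoubledHead w → ShortestBorder w ℓ → notTwo ℓ ≡ 1
doubledHead-admissible w 0 _ _ = refl
doubledHead-admissible w 1 _ _ = refl
doubledHead-admissible w 2 dh sb = ⊥-elim (doubledHead-border≢2 w dh sb)
doubledHead-admissible w (suc (suc (suc _))) _ _ = refl

-- g k = 1 + Σ g j over j < k with k − j ≠ 2, in first-order form with h k = 1 + Σ_{j<k} g j.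
g h : ℕ → ℕ
g 0 = 1
g 1 = 2
g (suc (suc k)) = g (suc k) + h k
h 0 = 1
h (suc k) = h k + g k

h≡ : ∀ k → h k ≡ 1 + sumBelow g k
h≡ zero = refl
h≡ (suc k) = cong (_+ g k) (h≡ k)

g-step : ∀ k → 1 + sumBelow (λ j → notTwo (k ∸ j) * g j) k ≤ g k
g-step 0 = ≤-refl
g-step 1 = ≤-refl
g-step (suc (suc k)) = begin
  1 + (sumBelow f k + f k + f (suc k)) ≡⟨ rearrange (sumBelow f k) (f k) (f (suc k)) ⟩
  f (suc k) + f k + (1 + sumBelow f k) ≤⟨ +-mono-≤ (+-mono-≤ top second) (s≤s (rest k)) ⟩
  g (suc k) + 0 + (1 + sumBelow g k) ≡⟨ cong₂ _+_ (+-identityʳ (g (suc k))) (sym (h≡ k)) ⟩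
  g (suc k) + h k ∎
  where
  open ≤-Reasoning
  f : ℕ → ℕ
  f j = notTwo (suc (suc k) ∸ j) * g j
  rearrange : ∀ a b c → 1 + (a + b + c) ≡ c + b + (1 + a)
  rearrange = solve-∀
  f≤g : ∀ j → f j ≤ g j
  f≤g j = ≤-trans (*-monoˡ-≤ (g j) (notTwo≤1 (suc (suc k) ∸ j))) (≤-reflexive (*-identityˡ (g j)))
  top : f (suc k) ≤ g (suc k)
  top = f≤g (suc k)
  -- The index `k` stands for a border of length 2, the one excluded length.
  second : f k ≤ 0
  second = ≤-reflexive (cong (λ z → notTwo z * g k) (m+n∸n≡m 2 k))
  rest : ∀ m → sumBelow f m ≤ sumBelow g m
  rest zero = z≤n
  rest (suc m) = +-mono-≤ (rest m) (f≤g m)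

-- The pair (4, 5) is a supersolution of the recursion for (g, h) with growth rate 9/5.
g-growth : ∀ k → 5 ^ k * g k ≤ 4 * 9 ^ k × 5 ^ suc k * g (suc k) ≤ 4 * 9 ^ suc k × 5 ^ k * h k ≤ 5 * 9 ^ k
g-growth zero = s≤s z≤n , m≤m+n 10 26 , s≤s z≤n
g-growth (suc k) with g-growth k
... | g₀ , g₁ , h₀ = g₁ , g₂ , h₁
  where
  open ≤-Reasoning
  p = 5 ^ k
  q = 9 ^ k
  g₂ : 5 ^ suc (suc k) * g (suc (suc k)) ≤ 4 * 9 ^ suc (suc k)
  g₂ = begin
    5 * (5 * p) * (g (suc k) + h k) ≡⟨ expand p (g (suc k)) (h k) ⟩
    5 * (5 * p * g (suc k)) + 25 * (p * h k) ≤⟨ +-mono-≤ (*-monoʳ-≤ 5 g₁) (*-monoʳ-≤ 25 h₀) ⟩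
    5 * (4 * (9 * q)) + 25 * (5 * q) ≡⟨ collect q ⟩
    305 * q ≤⟨ *-monoˡ-≤ q (m≤m+n 305 19) ⟩
    324 * q ≡⟨ spread q ⟩
    4 * (9 * (9 * q)) ∎
    where
    expand : ∀ p a b → 5 * (5 * p) * (a + b) ≡ 5 * (5 * p * a) + 25 * (p * b)
    expand = solve-∀
    collect : ∀ q → 5 * (4 * (9 * q)) + 25 * (5 * q) ≡ 305 * q
    collect = solve-∀
    spread : ∀ q → 324 * q ≡ 4 * (9 * (9 * q))
    spread = solve-∀
  h₁ : 5 ^ suc k * h (suc k) ≤ 5 * 9 ^ suc k
  h₁ = begin
    5 * p * (h k + g k) ≡⟨ expand p (h k) (g k) ⟩
    5 * (p * h k) + 5 * (p * g k) ≤⟨ +-mono-≤ (*-monoʳ-≤ 5 h₀) (*-monoʳ-≤ 5 g₀) ⟩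
    5 * (5 * q) + 5 * (4 * q) ≡⟨ collect q ⟩
    5 * (9 * q) ∎
    where
    expand : ∀ p a b → 5 * p * (a + b) ≡ 5 * (p * a) + 5 * (p * b)
    expand = solve-∀
    collect : ∀ q → 5 * (5 * q) + 5 * (4 * q) ≡ 5 * (9 * q)
    collect = solve-∀

-- Restores the first letter of a binary word whose first two letters differ. The value at the empty
-- word is a default, excluded by the length hypothesis of `length-flipCons`.
flipCons : Word 2 → Word 2
flipCons [] = []
flipCons (b ∷ r) = opposite b ∷ b ∷ r

≢⇒opposite : (a b : Fin 2) → a ≢ b → a ≡ opposite b
≢⇒opposite 0F 0F a≢b = ⊥-elim (a≢b refl)
≢⇒opposite 0F (sucF 0F) _ = refl
≢⇒opposite (sucF 0F) 0F _ = refl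
≢⇒opposite (sucF 0F) (sucF 0F) a≢b = ⊥-elim (a≢b refl)

data HeadView : Word 2 → Set where
  doubled : ∀ {w} → DoubledHead w → HeadView w
  flipped : ∀ w → HeadView (flipCons w)

headView : ∀ w → HeadView w
headView [] = doubled λ ()
headView (a ∷ []) = doubled λ ()
headView (a ∷ b ∷ r) with a Fin.≟ b
... | yes refl = doubled λ { refl → refl }
... | no a≢b = subst (λ c → HeadView (c ∷ b ∷ r)) (sym (≢⇒opposite a b a≢b)) (flipped (b ∷ r))

drop-flipCons : ∀ j w → drop j w ≡ drop (suc j) (flipCons w)
drop-flipCons j [] = drop-[] j
drop-flipCons j (b ∷ r) = refl

length-flipCons : ∀ w {m} → length (flipCons w) ≡ suc m → length w ≡ m
length-flipCons (b ∷ r) eq = suc-injective eq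

-- Either the word starts with a doubled letter, or its first letter is determined by the rest.
cover-all-bad : ∀ k M t → Cover {2} (λ w → ∀ j → j < t → Bad k (drop j w)) (t + (k + M))
  (2 ^ (k + M) + g k * 2 ^ (M + suc t))
-- The condition on front removals is now vacuous, so all words are kept; they give the first
-- summand of the bound.
cover-all-bad k M zero = cover-weaken (m≤m+n _ _) cover-all
cover-all-bad k M (suc t) = cover-weaken total (cover-⊆ split (cover-⊎ first
  (cover-image flipCons (cover-all-bad k M t))))
  where
  first : Cover {2} (λ w → Bad k w × DoubledHead w) (suc t + (k + M)) (g k * 2 ^ (M + suc t))
  first = subst (λ n → Cover {2} (λ w → Bad k w × DoubledHead w) n (g k * 2 ^ (M + suc t))) (reorder k M t)
    (cover-bad ≤-refl DoubledHead doubledHead-take notTwo g doubledHead-admissible g-step k (M + suc t))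
    where
    reorder : ∀ k M t → k + (M + suc t) ≡ suc t + (k + M)
    reorder = solve-∀
  -- The new term equals the one accumulated so far, so each further front removal doubles it.
  total : g k * 2 ^ (M + suc t) + (2 ^ (k + M) + g k * 2 ^ (M + suc t)) ≤ 2 ^ (k + M) + g k * 2 ^ (M + suc (suc t))
  total = ≤-reflexive (trans (double (g k) (2 ^ (M + suc t)) (2 ^ (k + M)))
    (cong (λ z → 2 ^ (k + M) + g k * 2 ^ z) (sym (+-suc M (suc t)))))
    where
    double : ∀ a b c → a * b + (c + a * b) ≡ c + a * (2 * b)
    double = solve-∀
  split : ∀ w → length w ≡ suc t + (k + M) → (∀ j → j < suc t → Bad k (drop j w)) →
    (Bad k w × DoubledHead w) ⊎
    (∃ λ s → length s ≡ t + (k + M) × (∀ j → j < t → Bad k (drop j s)) × w ≡ flipCons s)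
  split w n≡ bad with headView w
  ... | doubled dh = inj₁ (bad 0 (s≤s z≤n) , dh)
  ... | flipped s = inj₂ (s , length-flipCons s n≡ ,
          (λ j j<t → subst (Bad k) (sym (drop-flipCons j s)) (bad (suc j) (s≤s j<t))) , refl)

-- In a word of at least four letters the first two survive the removal of the last two. Hence a
-- shortest border of length 2 leaves a word whose first two letters differ.
doubledHead-unchop : (w : Word σ) → 4 ≤ length w → DoubledHead (chop 2 w) → DoubledHead w
doubledHead-unchop (a ∷ b ∷ c ∷ d ∷ r) _ dh refl = dh refl
doubledHead-unchop (a ∷ b ∷ []) (s≤s (s≤s ())) _ refl
doubledHead-unchop (a ∷ b ∷ c ∷ []) (s≤s (s≤s (s≤s ()))) _ refl

-- Shortest border of length 1, of length 2 (which forces distinct first letters), or longer.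
cover-bordered : ∀ M → Cover {2} (λ w → ¬ Unbordered w) (3 + M) (7 * 2 ^ M)
-- The three cases leave `2 + M` free letters, then `1 + M` letters of which the first is
-- determined, then a word of any length up to `M`.
cover-bordered M = cover-weaken total (cover-⊆ split (cover-⊎ (cover-⊎
  (cover-image {P = λ _ → ⊤} {M = 2 + M} (extend 1) cover-all)
  (cover-image (extend 2) (cover-image {P = λ _ → ⊤} {M = M} flipCons cover-all)))
  (cover-∃< (suc M) λ r _ → cover-image {P = λ _ → ⊤} {M = r} (extend (3 + M ∸ r)) cover-all)))
  where
  open ≤-Reasoning
  total : 2 ^ (2 + M) + 2 ^ M + sumBelow (2 ^_) (suc M) ≤ 7 * 2 ^ M
  total = begin
    2 ^ (2 + M) + 2 ^ M + sumBelow (2 ^_) (suc M)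
      ≤⟨ +-monoʳ-≤ (2 ^ (2 + M) + 2 ^ M) (sumBelow-^ ≤-refl (suc M)) ⟩
    2 ^ (2 + M) + 2 ^ M + 2 ^ suc M ≡⟨ collect (2 ^ M) ⟩
    7 * 2 ^ M ∎
    where
    collect : ∀ p → 2 * (2 * p) + p + 2 * p ≡ 7 * p
    collect = solve-∀
  split : ∀ w → length w ≡ 3 + M → ¬ Unbordered w →
    ((∃ λ s → length s ≡ 2 + M × ⊤ × w ≡ extend 1 s) ⊎
     (∃ λ s → length s ≡ suc M × (∃ λ s′ → length s′ ≡ M × ⊤ × s ≡ flipCons s′) × w ≡ extend 2 s)) ⊎
    (∃ λ r → r < suc M × ∃ λ s → length s ≡ r × ⊤ × w ≡ extend (3 + M ∸ r) s)
  split w n≡ bordered with shortest-border w bordered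
  ... | zero , sb = ⊥-elim (<⇒≱ (s≤s z≤n) (proj₁ (border sb)))
  ... | 1 , sb = inj₁ (inj₁ (chop 1 w , trans (length-chop 1 w) (cong (_∸ 1) n≡) , tt , extend-chop sb))
  ... | 2 , sb = inj₁ (inj₂ (chop 2 w , s-length , flip (headView (chop 2 w)) refl , extend-chop sb))
    where
    s-length : length (chop 2 w) ≡ suc M
    s-length = trans (length-chop 2 w) (cong (_∸ 2) n≡)
    flip : ∀ {s} → HeadView s → s ≡ chop 2 w → ∃ λ s′ → length s′ ≡ M × ⊤ × s ≡ flipCons s′
    flip (flipped s′) eq = s′ , length-flipCons s′ (trans (cong length eq) s-length) , tt , refl
    flip (doubled dh) refl = ⊥-elim (doubledHead-border≢2 w (doubledHead-unchop w (half sb) dh) sb)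
  ... | ℓ@(suc (suc (suc i))) , sb = inj₂ (length s , s<M , s , refl , tt ,
        trans (extend-chop sb) (cong (λ z → extend z s) ℓ≡))
    where
    s = chop ℓ w
    ℓ≤n : ℓ ≤ length w
    ℓ≤n = proj₁ (proj₂ (border sb))
    s<M : length s < suc M
    s<M = s≤s (begin
      length s ≡⟨ length-chop ℓ w ⟩
      length w ∸ ℓ ≡⟨ cong (_∸ ℓ) n≡ ⟩
      M ∸ i ≤⟨ m∸n≤m M i ⟩
      M ∎)
    ℓ≡ : ℓ ≡ 3 + M ∸ length s
    ℓ≡ = sym (trans (cong₂ _∸_ (sym n≡) (length-chop ℓ w)) (m∸[m∸n]≡n ℓ≤n))

-- The tail of n − L(S)

filter-length-mono : ∀ {P Q : Pred A 0ℓ} (P? : Decidable P) (Q? : Decidable Q) → (∀ {x} → P x → Q x) →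
  ∀ xs → length (filter P? xs) ≤ length (filter Q? xs)
filter-length-mono P? Q? P⇒Q [] = z≤n
filter-length-mono P? Q? P⇒Q (x ∷ xs) with P? x | Q? x
... | yes _ | yes _ = s≤s (filter-length-mono P? Q? P⇒Q xs)
... | yes p | no ¬q = ⊥-elim (¬q (P⇒Q p))
... | no _ | yes _ = m≤n⇒m≤1+n (filter-length-mono P? Q? P⇒Q xs)
... | no _ | no _ = filter-length-mono P? Q? P⇒Q xs

count≥ : (A → ℕ) → ℕ → List A → ℕ
count≥ f m ws = length (filter (λ w → m ≤? f w) ws)

-- σⁿ · Pr[n − L(S) ≥ m]
tail : (σ n m : ℕ) → ℕ
tail σ n m = count≥ (λ S → n ∸ L S) m (allWords σ n)

tail-cover : ∀ {P : Pred (Word σ) 0ℓ} n m → (∀ w → length w ≡ n → m ≤ defect w → P w) →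
  Cover P n c → tail σ n m ≤ c
tail-cover n m sub cov = cover-count (λ S → m ≤? n ∸ L S)
  (cover-⊆ (λ { w refl m≤ → sub w refl m≤ }) cov)

tail-none : ∀ {n m} → n < m → tail σ n m ≤ 0
tail-none {n = n} {m} n<m = tail-cover n m (λ _ _ m≤ → m≤)
  (cover-none λ { w refl m≤ → <⇒≱ n<m (≤-trans m≤ (m∸n≤m _ (L w))) })

tail-antitone : ∀ {n m m′} → m ≤ m′ → tail σ n m′ ≤ tail σ n m
tail-antitone {σ} {n} {m} {m′} m≤m′ = filter-length-mono
  (λ S → m′ ≤? n ∸ L S) (λ S → m ≤? n ∸ L S) (≤-trans m≤m′) (allWords σ n)

-- The whole defect is spent at the back, which leaves `n ∸ m` free letters for `cover-bad-power`;
-- for `m` above `n` the tail is empty.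
tail-power : 2 ≤ σ → ∀ n m → σ ^ m * tail σ n m ≤ 2 ^ m * σ ^ n
tail-power {σ} 2≤σ n m with m ≤? n
... | no m≰n = ≤-trans (*-monoʳ-≤ (σ ^ m) (tail-none {σ} (≰⇒> m≰n)))
                       (≤-trans (≤-reflexive (*-zeroʳ (σ ^ m))) z≤n)
... | yes m≤n with M ← n ∸ m | refl ← sym (m+[n∸m]≡n m≤n) = begin
  σ ^ m * tail σ (m + M) m ≤⟨ *-monoʳ-≤ (σ ^ m) (tail-cover (m + M) m
      (λ w _ m≤ → defect⇒bad w (s≤s m≤) 0 (s≤s z≤n)) (cover-bad-power 2≤σ m M)) ⟩
  σ ^ m * (2 ^ m * σ ^ M) ≡⟨ *-swap (σ ^ m) (2 ^ m) (σ ^ M) ⟩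
  2 ^ m * (σ ^ m * σ ^ M) ≡⟨ cong (2 ^ m *_) (^-distribˡ-+-* σ m M) ⟨
  2 ^ m * σ ^ (m + M) ∎
  where open ≤-Reasoning

^-distribʳ-* : ∀ n a b → (a * b) ^ n ≡ a ^ n * b ^ n
^-distribʳ-* zero a b = refl
^-distribʳ-* (suc n) a b rewrite ^-distribʳ-* n a b = *-interchange a b (a ^ n) (b ^ n)

-- Half the defect is spent at each end. Missing a doubled letter in `k` front removals contributes
-- at most `2^(-k)`, which is below `(9/10)^k`; the words reaching one contribute at most
-- `2 * g k / 2^k`, which is below `8 * (9/10)^k`. Together this gives the factor 9.
tail-binary : ∀ n k → 10 ^ k * tail 2 n (k + k) ≤ 9 ^ k * (9 * 2 ^ n)
tail-binary n k with k + k ≤? n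
... | no 2k≰n = ≤-trans (*-monoʳ-≤ (10 ^ k) (tail-none {2} (≰⇒> 2k≰n)))
                        (≤-trans (≤-reflexive (*-zeroʳ (10 ^ k))) z≤n)
... | yes 2k≤n with M ← n ∸ (k + k) | refl ← sym (trans (sym (+-assoc k k (n ∸ (k + k)))) (m+[n∸m]≡n 2k≤n)) = begin
  10 ^ k * tail 2 (k + (k + M)) (k + k) ≤⟨ *-monoʳ-≤ (10 ^ k) (tail-cover (k + (k + M)) (k + k)
      (λ w _ 2k≤ → defect⇒bad w (m≤n⇒m≤1+n 2k≤)) (cover-all-bad k M k)) ⟩
  10 ^ k * (2 ^ (k + M) + g k * 2 ^ (M + suc k))
    ≡⟨ cong₂ _*_ (^-distribʳ-* k 2 5) (cong₂ (λ a b → a + g k * b) (^-distribˡ-+-* 2 k M) (^-distribˡ-+-* 2 M (suc k))) ⟩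
  p * q * (p * r + g k * (r * (2 * p))) ≡⟨ expand p q r (g k) ⟩
  p * (p * r) * (q + 2 * (q * g k))
    ≤⟨ *-monoʳ-≤ (p * (p * r)) (+-mono-≤ (^-monoˡ-≤ k (m≤m+n 5 4)) (*-monoʳ-≤ 2 (proj₁ (g-growth k)))) ⟩
  p * (p * r) * (9 ^ k + 2 * (4 * 9 ^ k)) ≡⟨ collect (p * (p * r)) (9 ^ k) ⟩
  9 ^ k * (9 * (p * (p * r))) ≡⟨ cong (λ z → 9 ^ k * (9 * z))
      (trans (^-distribˡ-+-* 2 k (k + M)) (cong (p *_) (^-distribˡ-+-* 2 k M))) ⟨
  9 ^ k * (9 * 2 ^ (k + (k + M))) ∎
  where
  open ≤-Reasoning
  p = 2 ^ k
  q = 5 ^ k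
  r = 2 ^ M
  expand : ∀ p q r g → p * q * (p * r + g * (r * (2 * p))) ≡ p * (p * r) * (q + 2 * (q * g))
  expand = solve-∀
  collect : ∀ a b → a * (b + 2 * (4 * b)) ≡ b * (9 * a)
  collect = solve-∀

tail-binary-1 : ∀ n → 8 * tail 2 n 1 ≤ 7 * 2 ^ n
-- Lengths below 3 are settled by evaluating the count.
tail-binary-1 0 = ≤ᵇ⇒≤ _ _ tt
tail-binary-1 1 = ≤ᵇ⇒≤ _ _ tt
tail-binary-1 2 = ≤ᵇ⇒≤ _ _ tt
tail-binary-1 (suc (suc (suc M))) = begin
  8 * tail 2 (3 + M) 1 ≤⟨ *-monoʳ-≤ 8 (tail-cover (3 + M) 1 bordered (cover-bordered M)) ⟩
  8 * (7 * 2 ^ M) ≡⟨ spread (2 ^ M) ⟩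
  7 * 2 ^ (3 + M) ∎
  where
  open ≤-Reasoning
  spread : ∀ p → 8 * (7 * p) ≡ 7 * (2 * (2 * (2 * p)))
  spread = solve-∀
  bordered : ∀ w → length w ≡ 3 + M → 1 ≤ defect w → ¬ Unbordered w
  bordered w _ 1≤ u = <⇒≱ 1≤ (≤-trans (∸-monoʳ-≤ (length w)
    (unbordered⇒≤L w 0 (length w) ≤-refl (subst Unbordered (sym (take-all (length w) w ≤-refl)) u)))
    (≤-reflexive (n∸n≡0 (length w))))

-- Expectation

sumBelow-+ : ∀ f f′ n → sumBelow (λ k → f k + f′ k) n ≡ sumBelow f n + sumBelow f′ n
sumBelow-+ f f′ zero = refl
sumBelow-+ f f′ (suc n) rewrite sumBelow-+ f f′ n =
  +-interchange (sumBelow f n) (sumBelow f′ n) (f n) (f′ n)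

sumBelow-mono : ∀ {f f′} → (∀ k → f k ≤ f′ k) → ∀ n → sumBelow f n ≤ sumBelow f′ n
sumBelow-mono f≤f′ zero = z≤n
sumBelow-mono f≤f′ (suc n) = +-mono-≤ (sumBelow-mono f≤f′ n) (f≤f′ n)

-- Layer-cake summation: a value is at most `d` times the number of layers that it reaches. Width 2
-- suits the binary tail bound, which speaks of even thresholds only.
module _ (f : A → ℕ) (d : ℕ) where

  private
    layer : List A → ℕ → ℕ
    layer ws k = count≥ f (suc (k * d)) ws

  layer-full : ∀ w k → suc (k * d) ≤ f w → layer (w ∷ []) k ≡ 1
  layer-full w k p = cong length (filter-accept (λ w → suc (k * d) ≤? f w) p)

  value≤layers : ∀ w n → f w ≤ n * d → f w ≤ d * sumBelow (layer (w ∷ [])) n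
  value≤layers w zero f≤ = ≤-trans f≤ z≤n
  value≤layers w (suc n) f≤ with suc (n * d) ≤? f w
  ... | no ¬p = ≤-trans (value≤layers w n (≮⇒≥ ¬p)) (*-monoʳ-≤ d (m≤m+n _ _))
  ... | yes p = begin
    f w ≤⟨ f≤ ⟩
    suc n * d ≡⟨ *-comm (suc n) d ⟩
    d * suc n ≡⟨ cong (d *_) (full (suc n) ≤-refl) ⟨
    d * sumBelow (layer (w ∷ [])) (suc n) ∎
    where
    open ≤-Reasoning
    full : ∀ m → m ≤ suc n → sumBelow (layer (w ∷ [])) m ≡ m
    full zero _ = refl
    full (suc m) m<n = trans
      (cong₂ _+_ (full m (<⇒≤ m<n)) (layer-full w m (≤-trans (s≤s (*-monoˡ-≤ d (≤-pred m<n))) p)))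
      (+-comm m 1)

  sum≤layers : ∀ n → (∀ w → f w ≤ n * d) → ∀ ws → sum (map f ws) ≤ d * sumBelow (layer ws) n
  sum≤layers n f≤ [] = z≤n
  sum≤layers n f≤ (w ∷ ws) = begin
    f w + sum (map f ws) ≤⟨ +-mono-≤ (value≤layers w n (f≤ w)) (sum≤layers n f≤ ws) ⟩
    d * sumBelow (layer (w ∷ [])) n + d * sumBelow (layer ws) n ≡⟨ *-distribˡ-+ d _ _ ⟨
    d * (sumBelow (layer (w ∷ [])) n + sumBelow (layer ws) n)
      ≡⟨ cong (d *_) (sumBelow-+ (layer (w ∷ [])) (layer ws) n) ⟨
    d * sumBelow (λ k → layer (w ∷ []) k + layer ws k) n
      ≤⟨ *-monoʳ-≤ d (sumBelow-mono (λ k → ≤-reflexive (split k)) n) ⟩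
    d * sumBelow (layer (w ∷ ws)) n ∎
    where
    open ≤-Reasoning
    split : ∀ k → layer (w ∷ []) k + layer ws k ≡ layer (w ∷ ws) k
    split k = sym (trans (cong length (filter-++ (λ w → suc (k * d) ≤? f w) (w ∷ []) ws))
      (length-++ (filter (λ w → suc (k * d) ≤? f w) (w ∷ []))))

-- The geometric series of ratio `p / (p + r)`, free of division.
geometric-sum : ∀ p r B (a : ℕ → ℕ) → .{{NonZero (p + r)}} →
  (∀ k → (p + r) ^ k * a k ≤ p ^ k * B) → ∀ n → r * sumBelow a n ≤ (p + r) * B
geometric-sum p r B a a≤ n = *-cancelˡ-≤ (q ^ n) {{m^n≢0 q n}} (m+n≤o⇒m≤o _ (begin
  q ^ n * (r * sumBelow a n) + q * (p ^ n * B) ≤⟨ invariant n ⟩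
  q * (q ^ n * B) ≡⟨ *-swap q (q ^ n) B ⟩
  q ^ n * (q * B) ∎))
  where
  open ≤-Reasoning
  q = p + r
  -- In fractions, `r` times the partial sum is at most `q * B * (1 - (p/q)^n)`; the subtracted
  -- remainder is what lets the induction proceed.
  invariant : ∀ n → q ^ n * (r * sumBelow a n) + q * (p ^ n * B) ≤ q * (q ^ n * B)
  invariant zero = ≤-reflexive (cong (λ z → 1 * z + q * (1 * B)) (*-zeroʳ r))
  invariant (suc n) = begin
    q * q ^ n * (r * (sumBelow a n + a n)) + q * (p * p ^ n * B)
      ≡⟨ expand p r (q ^ n) (sumBelow a n) (a n) (p ^ n) B ⟩
    q * (q ^ n * (r * sumBelow a n) + r * (q ^ n * a n) + p * (p ^ n * B))
      ≤⟨ *-monoʳ-≤ q (+-monoˡ-≤ (p * (p ^ n * B)) (+-monoʳ-≤ (q ^ n * (r * sumBelow a n)) (*-monoʳ-≤ r (a≤ n)))) ⟩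
    q * (q ^ n * (r * sumBelow a n) + r * (p ^ n * B) + p * (p ^ n * B))
      ≡⟨ collect p r (q ^ n * (r * sumBelow a n)) (p ^ n * B) ⟩
    q * (q ^ n * (r * sumBelow a n) + q * (p ^ n * B)) ≤⟨ *-monoʳ-≤ q (invariant n) ⟩
    q * (q * (q ^ n * B)) ≡⟨ cong (q *_) (*-assoc q (q ^ n) B) ⟨
    q * (q * q ^ n * B) ∎
    where
    expand : ∀ p r Q S x P B → (p + r) * Q * (r * (S + x)) + (p + r) * (p * P * B)
      ≡ (p + r) * (Q * (r * S) + r * (Q * x) + p * (P * B))
    expand = solve-∀
    collect : ∀ p r X Y → (p + r) * (X + r * Y + p * Y) ≡ (p + r) * (X + (p + r) * Y)
    collect = solve-∀

totalDefect : ℕ → ℕ → ℕ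
totalDefect σ n = sum (map (λ S → n ∸ L S) (allWords σ n))

totalDefect-layers : ∀ σ n d .{{_ : NonZero d}} →
  totalDefect σ n ≤ d * sumBelow (λ k → tail σ n (suc (k * d))) n
totalDefect-layers σ n d =
  sum≤layers (λ S → n ∸ L S) d n (λ w → ≤-trans (m∸n≤m n (L w)) (m≤m*n n d)) (allWords σ n)

-- The powers of `2/σ` from the first on sum to `2 / (σ - 2)`, and `σ ≤ 3 * (σ - 2)` for three or
-- more letters; hence the constant 6.
totalDefect-large : ∀ σ n → 3 ≤ σ → σ * totalDefect σ n ≤ 6 * σ ^ n
totalDefect-large 0 n ()
totalDefect-large 1 n (s≤s ())
totalDefect-large 2 n (s≤s (s≤s ()))
totalDefect-large σ@(suc (suc (suc r))) n _ = begin
  σ * totalDefect σ n ≤⟨ *-monoˡ-≤ (totalDefect σ n) (σ≤3r r) ⟩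
  3 * suc r * totalDefect σ n ≡⟨ *-assoc 3 (suc r) _ ⟩
  3 * (suc r * totalDefect σ n) ≤⟨ *-monoʳ-≤ 3 defects ⟩
  3 * (2 * σ ^ n) ≡⟨ *-assoc 3 2 (σ ^ n) ⟨
  6 * σ ^ n ∎
  where
  open ≤-Reasoning
  σ≤3r : ∀ r → 2 + suc r ≤ 3 * suc r
  σ≤3r r = ≤-trans (m≤m+n (2 + suc r) (r + r)) (≤-reflexive (eq r))
    where
    eq : ∀ r → 2 + suc r + (r + r) ≡ 3 * suc r
    eq = solve-∀
  a : ℕ → ℕ
  a k = tail σ n (suc (k * 1))
  a≤ : ∀ k → σ ^ k * (σ * a k) ≤ 2 ^ k * (2 * σ ^ n)
  a≤ k rewrite *-identityʳ k = begin
    σ ^ k * (σ * tail σ n (suc k)) ≡⟨ assoc (σ ^ k) σ (tail σ n (suc k)) ⟩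
    σ ^ suc k * tail σ n (suc k) ≤⟨ tail-power {σ} (s≤s (s≤s z≤n)) n (suc k) ⟩
    2 ^ suc k * σ ^ n ≡⟨ assoc (2 ^ k) 2 (σ ^ n) ⟨
    2 ^ k * (2 * σ ^ n) ∎
    where
    assoc : ∀ a b c → a * (b * c) ≡ b * a * c
    assoc = solve-∀
  defects : suc r * totalDefect σ n ≤ 2 * σ ^ n
  -- The factor `σ` from starting the tail at 1 cancels against the `p + r` of the geometric series.
  defects = *-cancelˡ-≤ σ (begin
    σ * (suc r * totalDefect σ n) ≤⟨ *-monoʳ-≤ σ (*-monoʳ-≤ (suc r) (totalDefect-layers σ n 1)) ⟩
    σ * (suc r * (1 * sumBelow a n)) ≡⟨ swap σ (suc r) (sumBelow a n) ⟩
    suc r * (sumBelow a n * σ) ≡⟨ cong (suc r *_) (sumBelow-*ʳ a σ n) ⟨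
    suc r * sumBelow (λ k → a k * σ) n
      ≤⟨ geometric-sum 2 (suc r) (2 * σ ^ n) (λ k → a k * σ)
           (λ k → subst (λ z → σ ^ k * z ≤ 2 ^ k * (2 * σ ^ n)) (*-comm σ (a k)) (a≤ k)) n ⟩
    σ * (2 * σ ^ n) ∎)
    where
    swap : ∀ a b c → a * (b * (1 * c)) ≡ b * (c * a)
    swap = solve-∀

-- The constant is `2 * 2 * 10 * 9`: alphabet size, layer width, sum of the powers of 9/10, and the
-- factor from `tail-binary`.
totalDefect-binary : ∀ n → 2 * totalDefect 2 n ≤ 360 * 2 ^ n
totalDefect-binary n = begin
  2 * totalDefect 2 n ≤⟨ *-monoʳ-≤ 2 (totalDefect-layers 2 n 2) ⟩
  2 * (2 * sumBelow (λ k → tail 2 n (suc (k * 2))) n)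
    ≤⟨ *-monoʳ-≤ 2 (*-monoʳ-≤ 2 (sumBelow-mono (λ k → tail-antitone {2} {n} (2k≤ k)) n)) ⟩
  2 * (2 * sumBelow a n) ≡⟨ cong (λ z → 2 * (2 * z)) (*-identityˡ (sumBelow a n)) ⟨
  2 * (2 * (1 * sumBelow a n)) ≤⟨ *-monoʳ-≤ 2 (*-monoʳ-≤ 2 (geometric-sum 9 1 (9 * 2 ^ n) a (tail-binary n) n)) ⟩
  2 * (2 * (10 * (9 * 2 ^ n))) ≡⟨ collect (2 ^ n) ⟩
  360 * 2 ^ n ∎
  where
  open ≤-Reasoning
  a : ℕ → ℕ
  a k = tail 2 n (k + k)
  2k≤ : ∀ k → k + k ≤ suc (k * 2)
  2k≤ k = m≤n⇒m≤1+n (≤-reflexive (trans (cong (k +_) (sym (+-identityʳ k))) (*-comm 2 k)))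
  collect : ∀ p → 2 * (2 * (10 * (9 * p))) ≡ 360 * p
  collect = solve-∀

totalDefect-bound : ∀ σ n → 2 ≤ σ → σ * totalDefect σ n ≤ 360 * σ ^ n
totalDefect-bound 2 n _ = totalDefect-binary n
totalDefect-bound σ@(suc (suc (suc _))) n _ =
  ≤-trans (totalDefect-large σ n (s≤s (s≤s (s≤s z≤n)))) (*-monoˡ-≤ (σ ^ n) (m≤m+n 6 354))
totalDefect-bound 1 n (s≤s ())

expectation-lower : ∀ σ n → n * σ ^ n ∸ totalL σ n ≤ totalDefect σ n
expectation-lower σ n = m≤n+o⇒m∸n≤o _ (totalL σ n)
  (subst (λ z → n * z ≤ totalL σ n + totalDefect σ n) (allWords-length σ n) (go (allWords σ n)))
  where
  open ≤-Reasoning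
  go : ∀ ws → n * length ws ≤ sum (map L ws) + sum (map (λ S → n ∸ L S) ws)
  go [] = ≤-reflexive (*-zeroʳ n)
  go (w ∷ ws) = begin
    n * suc (length ws) ≡⟨ *-suc n (length ws) ⟩
    n + n * length ws ≤⟨ +-mono-≤ (m≤n+m∸n n (L w)) (go ws) ⟩
    L w + (n ∸ L w) + (sum (map L ws) + sum (map (λ S → n ∸ L S) ws))
      ≡⟨ +-interchange (L w) (n ∸ L w) (sum (map L ws)) _ ⟩
    L w + sum (map L ws) + (n ∸ L w + sum (map (λ S → n ∸ L S) ws)) ∎

-- Makes the truncated difference `totalL σ n ∸ n * σ ^ n` vanish.
expectation-upper : ∀ σ n → totalL σ n ≤ n * σ ^ n
expectation-upper σ n = subst (λ z → totalL σ n ≤ n * z) (allWords-length σ n)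
  (go (allWords σ n) (λ {w} w∈ → ≤-trans (L≤length w) (≤-reflexive (allWords-sound n w∈))))
  where
  go : ∀ ws → (∀ {w} → w ∈ ws → L w ≤ n) → sum (map L ws) ≤ n * length ws
  go [] _ = z≤n
  go (w ∷ ws) L≤ = ≤-trans (+-mono-≤ (L≤ (here refl)) (go ws (λ w∈ → L≤ (there w∈))))
    (≤-reflexive (sym (*-suc n (length ws))))

-- Concentration

^-mono-ratio : ∀ j {a b x y} → a * x ≤ b * y → a ^ j * x ^ j ≤ b ^ j * y ^ j
^-mono-ratio j {a} {b} {x} {y} ax≤by = begin
  a ^ j * x ^ j ≡⟨ ^-distribʳ-* j a x ⟨
  (a * x) ^ j ≤⟨ ^-monoˡ-≤ j ax≤by ⟩
  (b * y) ^ j ≡⟨ ^-distribʳ-* j b y ⟩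
  b ^ j * y ^ j ∎
  where open ≤-Reasoning

^-comm : ∀ a m n → (a ^ m) ^ n ≡ (a ^ n) ^ m
^-comm a m n = trans (^-*-assoc a m n) (trans (cong (a ^_) (*-comm m n)) (sym (^-*-assoc a n m)))

-- In fractions: x/y ≤ b/a ≤ 1/c.
ratio-absorb : ∀ {a b c x y} .{{_ : NonZero a}} → c * b ≤ a → a * x ≤ b * y → c * x ≤ y
ratio-absorb {a} {b} {c} {x} {y} cb≤a ax≤by = *-cancelˡ-≤ a (begin
  a * (c * x) ≡⟨ *-swap a c x ⟩
  c * (a * x) ≤⟨ *-monoʳ-≤ c ax≤by ⟩
  c * (b * y) ≡⟨ *-assoc c b y ⟨
  c * b * y ≤⟨ *-monoˡ-≤ y cb≤a ⟩
  a * y ∎)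
  where open ≤-Reasoning

-- (x / y) ^ i ≤ 1 / a.  A record, so that powers with large numeral exponents are never unfolded.
record Decay (x y a i : ℕ) : Set where
  constructor decay
  field bound : a * x ^ i ≤ y ^ i

decay-weaken : ∀ {x y a b i} → a ≤ b → Decay x y b i → Decay x y a i
decay-weaken {x} {i = i} a≤b (decay b) = decay (≤-trans (*-monoˡ-≤ (x ^ i) a≤b) b)

decay-1 : ∀ {x y i} → x ≤ y → Decay x y 1 i
decay-1 {i = i} x≤y = decay (≤-trans (≤-reflexive (*-identityˡ _)) (^-monoˡ-≤ i x≤y))

decay-* : ∀ {x y a b i j} → Decay x y a i → Decay x y b j → Decay x y (a * b) (i + j)
decay-* {x} {y} {a} {b} {i} {j} (decay p) (decay q) = decay (begin
  a * b * x ^ (i + j) ≡⟨ cong (a * b *_) (^-distribˡ-+-* x i j) ⟩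
  a * b * (x ^ i * x ^ j) ≡⟨ *-interchange a b (x ^ i) (x ^ j) ⟩
  a * x ^ i * (b * x ^ j) ≤⟨ *-mono-≤ p q ⟩
  y ^ i * y ^ j ≡⟨ ^-distribˡ-+-* y i j ⟨
  y ^ (i + j) ∎)
  where open ≤-Reasoning

-- In fractions: `(x/y)^i ≤ b/a` and `(b/a)^n ≤ 1/c`.
decay-^ : ∀ {x y a b c} i n .{{_ : NonZero a}} → c * b ^ n ≤ a ^ n → a * x ^ i ≤ b * y ^ i → Decay x y c (i * n)
decay-^ {x} {y} {a} {b} {c} i n cbⁿ≤aⁿ ratio = decay (subst₂ (λ u v → c * u ≤ v) (^-*-assoc x i n) (^-*-assoc y i n)
  (ratio-absorb {b = b ^ n} {c = c} {{m^n≢0 a n}} cbⁿ≤aⁿ (^-mono-ratio n {a} {b} ratio)))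

decay-ratio : ∀ {x y a b c} n .{{_ : NonZero a}} → c * b ^ n ≤ a ^ n → a * x ≤ b * y → Decay x y c n
decay-ratio {x} {y} {a} {b} {c} n cbⁿ≤aⁿ ratio =
  decay (ratio-absorb {b = b ^ n} {c = c} {{m^n≢0 a n}} cbⁿ≤aⁿ (^-mono-ratio n {a} {b} ratio))

tail≤ : ∀ σ n m → tail σ n m ≤ σ ^ n
tail≤ σ n m = cover-count {N = n} (λ S → m ≤? n ∸ L S) cover-all

-- For σ ≥ 3 the tail is at most (2/σ)^m ≤ σ^(−m/3), since 2³ ≤ 3².
tail-decay-large : ∀ σ n m → 3 ≤ σ → Decay (tail σ n m) (σ ^ n) (σ ^ m) 3
tail-decay-large σ n m 3≤σ = decay-ratio {a = σ ^ m} {b = 2 ^ m} 3 {{m^n≢0 σ m}} (begin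
    σ ^ m * (2 ^ m) ^ 3 ≡⟨ cong (σ ^ m *_) (^-comm 2 m 3) ⟩
    σ ^ m * 8 ^ m ≤⟨ *-monoʳ-≤ (σ ^ m) (^-monoˡ-≤ m (≤-trans (n≤1+n 8) (^-monoˡ-≤ 2 3≤σ))) ⟩
    σ ^ m * (σ ^ 2) ^ m ≡⟨ cong (σ ^ m *_) (^-comm σ 2 m) ⟩
    (σ ^ m) ^ 3 ∎)
  (tail-power (≤-trans (n≤1+n 2) 3≤σ) n m)
  where
  open ≤-Reasoning
  instance
    σ≢0 : NonZero σ
    σ≢0 = >-nonZero (≤-trans (s≤s z≤n) 3≤σ)

-- Combines x/y ≤ 9(9/10)^k and x/y ≤ 7/8, using 9·7¹⁷ ≤ 8¹⁷ and 2·9⁷ ≤ 10⁷.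
binary-decay : ∀ {x y} k → 10 ^ k * x ≤ 9 ^ k * (9 * y) → 8 * x ≤ 7 * y → Decay x y (2 ^ k) 126
binary-decay {x} {y} k x-decay 8x≤7y = decay-^ {a = 10 ^ k} {b = 9 ^ k} 18 7 {{m^n≢0 10 k}} (begin
    2 ^ k * (9 ^ k) ^ 7 ≡⟨ cong (2 ^ k *_) (^-comm 9 k 7) ⟩
    2 ^ k * (9 ^ 7) ^ k ≡⟨ ^-distribʳ-* k 2 (9 ^ 7) ⟨
    (2 * 9 ^ 7) ^ k ≤⟨ ^-monoˡ-≤ k (≤ᵇ⇒≤ (2 * 9 ^ 7) (10 ^ 7) tt) ⟩
    (10 ^ 7) ^ k ≡⟨ ^-comm 10 7 k ⟩
    (10 ^ k) ^ 7 ∎)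
  combined
  where
  open ≤-Reasoning
  -- One of the 18 factors carries the exponential decay; the other 17 absorb the constant 9.
  combined : 10 ^ k * x ^ 18 ≤ 9 ^ k * y ^ 18
  combined = begin
    10 ^ k * (x * x ^ 17) ≡⟨ *-assoc (10 ^ k) x _ ⟨
    10 ^ k * x * x ^ 17 ≤⟨ *-monoˡ-≤ (x ^ 17) x-decay ⟩
    9 ^ k * (9 * y) * x ^ 17 ≡⟨ regroup (9 ^ k) 9 y (x ^ 17) ⟩
    9 ^ k * (y * (9 * x ^ 17)) ≤⟨ *-monoʳ-≤ (9 ^ k) (*-monoʳ-≤ y
      (Decay.bound (decay-ratio {x} {y} {a = 8} {b = 7} {c = 9} 17 (≤ᵇ⇒≤ (9 * 7 ^ 17) (8 ^ 17) tt) 8x≤7y))) ⟩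
    9 ^ k * (y * y ^ 17) ∎
    where
    regroup : ∀ a b c d → a * (b * c) * d ≡ a * (c * (b * d))
    regroup = solve-∀

half-split : ∀ m → ∃ λ k → k + k ≤ m × m ≤ suc (k + k)
half-split zero = 0 , z≤n , z≤n
half-split 1 = 0 , z≤n , ≤-refl
half-split (suc (suc m)) with half-split m
... | k , lo , hi = suc k , s≤s (≤-trans (≤-reflexive (+-suc k k)) (s≤s lo)) ,
  s≤s (≤-trans (s≤s hi) (≤-reflexive (cong suc (sym (+-suc k k)))))

-- The exponent is `6 + 126 + 126`: the sixth power of 7/8 is below 1/2, which accounts for an odd
-- `m`, and each `binary-decay` supplies `2 ^ k`. The bound 7/8 concerns positive thresholds, so
-- `m = 0` stands apart.
tail-decay-binary : ∀ n m → Decay (tail 2 n m) (2 ^ n) (2 ^ m) 258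
tail-decay-binary n zero = decay-1 (tail≤ 2 n 0)
tail-decay-binary n m@(suc _) with half-split m
... | k , 2k≤m , m≤2k+1 = decay-weaken 2^m≤ (decay-*
  (decay-ratio {a = 8} {b = 7} {c = 2} 6 (≤ᵇ⇒≤ (2 * 7 ^ 6) (8 ^ 6) tt) 8x≤7y)
  (decay-* (binary-decay k x-decay 8x≤7y) (binary-decay k x-decay 8x≤7y)))
  where
  8x≤7y : 8 * tail 2 n m ≤ 7 * 2 ^ n
  8x≤7y = ≤-trans (*-monoʳ-≤ 8 (tail-antitone {2} {n} (s≤s z≤n))) (tail-binary-1 n)
  x-decay : 10 ^ k * tail 2 n m ≤ 9 ^ k * (9 * 2 ^ n)
  x-decay = ≤-trans (*-monoʳ-≤ (10 ^ k) (tail-antitone {2} {n} 2k≤m)) (tail-binary n k)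
  2^m≤ : 2 ^ m ≤ 2 * (2 ^ k * 2 ^ k)
  2^m≤ = ≤-trans (^-monoʳ-≤ 2 m≤2k+1) (≤-reflexive (cong (2 *_) (^-distribˡ-+-* 2 k k)))

tail-decay : ∀ σ n m → 2 ≤ σ → Decay (tail σ n m) (σ ^ n) (σ ^ m) 258
tail-decay 1 n m (s≤s ())
tail-decay 2 n m _ = tail-decay-binary n m
-- Exponent 3 suffices here; the other 255 factors are bounded by 1 to reach the common exponent.
tail-decay σ@(suc (suc (suc _))) n m _ = decay-weaken (≤-reflexive (sym (*-identityʳ (σ ^ m))))
  (decay-* (tail-decay-large σ n m (s≤s (s≤s (s≤s z≤n)))) (decay-1 (tail≤ σ n m)))

-- Naturals as rational numbers

toℚᵘ-ℕ→ℚ : ∀ k → ℚ.toℚᵘ (ℕ→ℚ k) ℚᵘ.≃ mkℚᵘ (ℤ.+ k) 0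
toℚᵘ-ℕ→ℚ k = ℚ.toℚᵘ-fromℚᵘ (mkℚᵘ (ℤ.+ k) 0)

-- Checked on unnormalised fractions, where all denominators are 1 and the identity becomes one of
-- integers.
ℕ→ℚ-* : ∀ a b → ℕ→ℚ (a * b) ≡ ℕ→ℚ a ℚ.* ℕ→ℚ b
ℕ→ℚ-* a b = ℚ.toℚᵘ-injective (begin
  ℚ.toℚᵘ (ℕ→ℚ (a * b)) ≈⟨ toℚᵘ-ℕ→ℚ (a * b) ⟩
  mkℚᵘ (ℤ.+ (a * b)) 0 ≈⟨ *≡* (cong (ℤ._* ℤ.+ 1) (ℤ.pos-* a b)) ⟩
  mkℚᵘ (ℤ.+ a) 0 ℚᵘ.* mkℚᵘ (ℤ.+ b) 0 ≈⟨ ℚᵘ.*-cong (toℚᵘ-ℕ→ℚ a) (toℚᵘ-ℕ→ℚ b) ⟨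
  ℚ.toℚᵘ (ℕ→ℚ a) ℚᵘ.* ℚ.toℚᵘ (ℕ→ℚ b) ≈⟨ ℚ.toℚᵘ-homo-* (ℕ→ℚ a) (ℕ→ℚ b) ⟨
  ℚ.toℚᵘ (ℕ→ℚ a ℚ.* ℕ→ℚ b) ∎)
  where open import Relation.Binary.Reasoning.Setoid ℚᵘ.≃-setoid

ℕ→ℚ-+ : ∀ a b → ℕ→ℚ (a + b) ≡ ℕ→ℚ a ℚ.+ ℕ→ℚ b
ℕ→ℚ-+ a b = ℚ.toℚᵘ-injective (begin
  ℚ.toℚᵘ (ℕ→ℚ (a + b)) ≈⟨ toℚᵘ-ℕ→ℚ (a + b) ⟩
  mkℚᵘ (ℤ.+ (a + b)) 0 ≈⟨ *≡* (cong (ℤ._* ℤ.+ 1) (trans (ℤ.pos-+ a b)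
    (sym (cong₂ ℤ._+_ (ℤ.*-identityʳ (ℤ.+ a)) (ℤ.*-identityʳ (ℤ.+ b)))))) ⟩
  mkℚᵘ (ℤ.+ a) 0 ℚᵘ.+ mkℚᵘ (ℤ.+ b) 0 ≈⟨ ℚᵘ.+-cong (toℚᵘ-ℕ→ℚ a) (toℚᵘ-ℕ→ℚ b) ⟨
  ℚ.toℚᵘ (ℕ→ℚ a) ℚᵘ.+ ℚ.toℚᵘ (ℕ→ℚ b) ≈⟨ ℚ.toℚᵘ-homo-+ (ℕ→ℚ a) (ℕ→ℚ b) ⟨
  ℚ.toℚᵘ (ℕ→ℚ a ℚ.+ ℕ→ℚ b) ∎)
  where open import Relation.Binary.Reasoning.Setoid ℚᵘ.≃-setoid

ℕ→ℚ-mono : ∀ {a b} → a ≤ b → ℕ→ℚ a ℚ.≤ ℕ→ℚ b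
ℕ→ℚ-mono {a} {b} a≤b = ℚ.toℚᵘ-cancel-≤
  (ℚᵘ.≤-respʳ-≃ (ℚᵘ.≃-sym (toℚᵘ-ℕ→ℚ b)) (ℚᵘ.≤-respˡ-≃ (ℚᵘ.≃-sym (toℚᵘ-ℕ→ℚ a))
    (*≤* (ℤ.*-monoʳ-≤-nonNeg (ℤ.+ 1) (ℤ.+≤+ a≤b)))))

ℕ→ℚ-nonNeg : ∀ k → ℚ.NonNegative (ℕ→ℚ k)
ℕ→ℚ-nonNeg k = ℚ.nonNegative (ℕ→ℚ-mono (z≤n {k}))

ℕ→ℚ-^ : ∀ a j → ℕ→ℚ (a ^ j) ≡ ℕ→ℚ a ^ℚ j
ℕ→ℚ-^ a zero = refl
ℕ→ℚ-^ a (suc j) = trans (ℕ→ℚ-* a (a ^ j)) (cong (ℕ→ℚ a ℚ.*_) (ℕ→ℚ-^ a j))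

^ℚ-distrib-* : ∀ p q j → (p ℚ.* q) ^ℚ j ≡ p ^ℚ j ℚ.* q ^ℚ j
^ℚ-distrib-* p q zero = refl
^ℚ-distrib-* p q (suc j) rewrite ^ℚ-distrib-* p q j = interchange p q (p ^ℚ j) (q ^ℚ j)
  where open CommutativeSemigroupProperties (CommutativeRing.*-commutativeSemigroup ℚ.+-*-commutativeRing)

^ℚ-nonNeg : ∀ p j → .{{ℚ.NonNegative p}} → ℚ.NonNegative (p ^ℚ j)
^ℚ-nonNeg p zero = _
^ℚ-nonNeg p (suc j) = ℚ.nonNeg*nonNeg⇒nonNeg p (p ^ℚ j) {{^ℚ-nonNeg p j}}

^ℚ-mono : ∀ {p q} j → .{{ℚ.NonNegative p}} → p ℚ.≤ q → p ^ℚ j ℚ.≤ q ^ℚ j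
^ℚ-mono zero p≤q = ℚ.≤-refl
^ℚ-mono {p} {q} (suc j) p≤q = begin
  p ℚ.* p ^ℚ j ≤⟨ ℚ.*-monoˡ-≤-nonNeg p (^ℚ-mono j p≤q) ⟩
  p ℚ.* q ^ℚ j ≤⟨ ℚ.*-monoʳ-≤-nonNeg (q ^ℚ j) {{^ℚ-nonNeg q j {{ℚ.nonNegative (ℚ.≤-trans (ℚ.nonNegative⁻¹ p) p≤q)}}}} p≤q ⟩
  q ℚ.* q ^ℚ j ∎
  where open ℚ.≤-Reasoning

-- Contrapositive: if δ < c/N then δ^C·s ≤ (c/N)^C·s ≤ 1.
ratio≤δ : ∀ C {s c N} δ → .{{NonZero N}} → 0ℚ ℚ.< δ → Decay c N s C →
  ¬ (δ ^ℚ C ℚ.* ℕ→ℚ s ℚ.≤ 1ℚ) → ℕ→ℚ c ℚ.≤ δ ℚ.* ℕ→ℚ N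
ratio≤δ C {s} {c} {N} δ 0<δ (decay bound) large = ℚ.≮⇒≥ λ δN<c → large (small (ℚ.<⇒≤ δN<c))
  where
  open ℚ.≤-Reasoning
  instance
    δ≥0 : ℚ.NonNegative δ
    δ≥0 = ℚ.nonNegative (ℚ.<⇒≤ 0<δ)
    s≥0 : ℚ.NonNegative (ℕ→ℚ s)
    s≥0 = ℕ→ℚ-nonNeg s
    N≥0 : ℚ.NonNegative (ℕ→ℚ N)
    N≥0 = ℕ→ℚ-nonNeg N
    δN≥0 : ℚ.NonNegative (δ ℚ.* ℕ→ℚ N)
    δN≥0 = ℚ.nonNeg*nonNeg⇒nonNeg δ (ℕ→ℚ N)
    N^C>0 : ℚ.Positive (ℕ→ℚ (N ^ C))
    N^C>0 = ℚ.positive (ℚ.<-≤-trans (ℚ.positive⁻¹ 1ℚ) (ℕ→ℚ-mono (m^n>0 N C)))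
  small : δ ℚ.* ℕ→ℚ N ℚ.≤ ℕ→ℚ c → δ ^ℚ C ℚ.* ℕ→ℚ s ℚ.≤ 1ℚ
  small δN≤c = ℚ.*-cancelʳ-≤-pos (ℕ→ℚ (N ^ C)) (begin
    δ ^ℚ C ℚ.* ℕ→ℚ s ℚ.* ℕ→ℚ (N ^ C) ≡⟨ cong (δ ^ℚ C ℚ.* ℕ→ℚ s ℚ.*_) (ℕ→ℚ-^ N C) ⟩
    δ ^ℚ C ℚ.* ℕ→ℚ s ℚ.* ℕ→ℚ N ^ℚ C ≡⟨ ℚ.*-assoc (δ ^ℚ C) _ _ ⟩
    δ ^ℚ C ℚ.* (ℕ→ℚ s ℚ.* ℕ→ℚ N ^ℚ C) ≡⟨ cong (δ ^ℚ C ℚ.*_) (ℚ.*-comm (ℕ→ℚ s) _) ⟩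
    δ ^ℚ C ℚ.* (ℕ→ℚ N ^ℚ C ℚ.* ℕ→ℚ s) ≡⟨ ℚ.*-assoc (δ ^ℚ C) _ _ ⟨
    δ ^ℚ C ℚ.* ℕ→ℚ N ^ℚ C ℚ.* ℕ→ℚ s ≡⟨ cong (ℚ._* ℕ→ℚ s) (^ℚ-distrib-* δ (ℕ→ℚ N) C) ⟨
    (δ ℚ.* ℕ→ℚ N) ^ℚ C ℚ.* ℕ→ℚ s ≤⟨ ℚ.*-monoʳ-≤-nonNeg (ℕ→ℚ s) (^ℚ-mono C δN≤c) ⟩
    ℕ→ℚ c ^ℚ C ℚ.* ℕ→ℚ s ≡⟨ cong (ℚ._* ℕ→ℚ s) (ℕ→ℚ-^ c C) ⟨
    ℕ→ℚ (c ^ C) ℚ.* ℕ→ℚ s ≡⟨ ℚ.*-comm (ℕ→ℚ (c ^ C)) _ ⟩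
    ℕ→ℚ s ℚ.* ℕ→ℚ (c ^ C) ≡⟨ ℕ→ℚ-* s (c ^ C) ⟨
    ℕ→ℚ (s * c ^ C) ≤⟨ ℕ→ℚ-mono bound ⟩
    ℕ→ℚ (N ^ C) ≡⟨ ℚ.*-identityˡ _ ⟨
    1ℚ ℚ.* ℕ→ℚ (N ^ C) ∎)

complement : ∀ N good {c} δ → N ≤ good + c → ℕ→ℚ c ℚ.≤ δ ℚ.* ℕ→ℚ N →
  (1ℚ ℚ.- δ) ℚ.* ℕ→ℚ N ℚ.≤ ℕ→ℚ good
complement N good {c} δ N≤ c≤ = begin
  (1ℚ ℚ.- δ) ℚ.* n ≡⟨ ℚ.*-distribʳ-+ n 1ℚ (ℚ.- δ) ⟩
  1ℚ ℚ.* n ℚ.+ ℚ.- δ ℚ.* n ≡⟨ cong₂ ℚ._+_ (ℚ.*-identityˡ n) (sym (ℚ.neg-distribˡ-* δ n)) ⟩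
  n ℚ.- δ ℚ.* n ≤⟨ ℚ.+-mono-≤ (ℕ→ℚ-mono N≤) (ℚ.neg-antimono-≤ c≤) ⟩
  ℕ→ℚ (good + c) ℚ.- ℕ→ℚ c ≡⟨ cong (ℚ._- ℕ→ℚ c) (ℕ→ℚ-+ good c) ⟩
  ℕ→ℚ good ℚ.+ ℕ→ℚ c ℚ.- ℕ→ℚ c ≡⟨ ℚ.+-assoc (ℕ→ℚ good) _ _ ⟩
  ℕ→ℚ good ℚ.+ (ℕ→ℚ c ℚ.- ℕ→ℚ c) ≡⟨ cong (ℕ→ℚ good ℚ.+_) (ℚ.+-inverseʳ (ℕ→ℚ c)) ⟩
  ℕ→ℚ good ℚ.+ 0ℚ ≡⟨ ℚ.+-identityʳ _ ⟩
  ℕ→ℚ good ∎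
  where
  open ℚ.≤-Reasoning
  n = ℕ→ℚ N

filter-length-cover : ∀ {P Q : Pred A 0ℓ} (P? : Decidable P) (Q? : Decidable Q) → (∀ x → ¬ P x → Q x) →
  ∀ xs → length xs ≤ length (filter P? xs) + length (filter Q? xs)
filter-length-cover P? Q? P∨Q [] = z≤n
filter-length-cover P? Q? P∨Q (x ∷ xs) with P? x | Q? x
... | yes _ | yes _ = s≤s (≤-trans (filter-length-cover P? Q? P∨Q xs) (+-monoʳ-≤ (length (filter P? xs)) (n≤1+n _)))
... | yes _ | no _ = s≤s (filter-length-cover P? Q? P∨Q xs)
... | no _ | yes _ = ≤-trans (s≤s (filter-length-cover P? Q? P∨Q xs)) (≤-reflexive (sym (+-suc _ _)))
... | no ¬p | no ¬q = ⊥-elim (¬q (P∨Q x ¬p))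

least-failure : ∀ {P : Pred ℕ 0ℓ} → Decidable P → ∀ m →
  (∀ i → i < m → P i) ⊎ ∃ λ i → ¬ P i × (∀ j → j < i → P j)
least-failure P? zero = inj₁ λ _ ()
least-failure {P} P? (suc m) with least-failure P? m
... | inj₂ found = inj₂ found
... | inj₁ below with P? m
...   | no ¬pm = inj₂ (m , ¬pm , below)
...   | yes pm = inj₁ up-to
  where
  up-to : ∀ i → i < suc m → P i
  up-to i (s≤s i≤m) with m≤n⇒m<n∨m≡n i≤m
  ... | inj₁ i<m = below i i<m
  ... | inj₂ refl = pm

filter-below : ∀ {P : Pred ℕ 0ℓ} (P? : Decidable P) (f : A → ℕ) m → (∀ j → j < m → P j) →
  ∀ xs → length xs ≤ length (filter (λ x → P? (f x)) xs) + count≥ f m xs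
filter-below P? f m below = filter-length-cover (λ x → P? (f x)) (λ x → m ≤? f x)
  (λ x ¬p → ≮⇒≥ λ fx<m → ¬p (below (f x) fx<m))

-- The words violating the inequality have defect at least m, the least number violating it.
module _ (C σ n : ℕ) (δ : ℚ) (2≤σ : 2 ≤ σ) (0<δ : 0ℚ ℚ.< δ)
  (tail-bound : ∀ m → Decay (tail σ n m) (σ ^ n) (σ ^ m) C) where

  private
    Good : Pred ℕ 0ℓ
    Good m = δ ^ℚ C ℚ.* ℕ→ℚ (σ ^ m) ℚ.≤ 1ℚ

    good? : Decidable Good
    good? m = (δ ^ℚ C ℚ.* ℕ→ℚ (σ ^ m)) ℚ.≤? 1ℚ

  good-or-tail : ∀ m → (∀ j → j < m → Good j) → σ ^ n ≤ goodCount C σ n δ + tail σ n m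
  good-or-tail m below = ≤-trans (≤-reflexive (sym (allWords-length σ n)))
    (filter-below good? (λ S → n ∸ L S) m below (allWords σ n))

  concentration : (1ℚ ℚ.- δ) ℚ.* ℕ→ℚ (σ ^ n) ℚ.≤ ℕ→ℚ (goodCount C σ n δ)
  -- Defects never exceed `n`, so the search stops there: if nothing fails up to `n`, the tail at
  -- `n + 1` is empty.
  concentration = [ none , some ]′ (least-failure good? (suc n))
    where
    open ℚ.≤-Reasoning
    none : (∀ m → m < suc n → Good m) → (1ℚ ℚ.- δ) ℚ.* ℕ→ℚ (σ ^ n) ℚ.≤ ℕ→ℚ (goodCount C σ n δ)
    none below = complement _ _ {c = tail σ n (suc n)} δ (good-or-tail (suc n) below) (begin
      ℕ→ℚ (tail σ n (suc n)) ≤⟨ ℕ→ℚ-mono (tail-none {σ} {n} ≤-refl) ⟩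
      0ℚ ≡⟨ ℚ.*-zeroˡ (ℕ→ℚ (σ ^ n)) ⟨
      0ℚ ℚ.* ℕ→ℚ (σ ^ n) ≤⟨ ℚ.*-monoʳ-≤-nonNeg (ℕ→ℚ (σ ^ n)) {{ℕ→ℚ-nonNeg (σ ^ n)}} (ℚ.<⇒≤ 0<δ) ⟩
      δ ℚ.* ℕ→ℚ (σ ^ n) ∎)
    some : (∃ λ m → ¬ Good m × (∀ j → j < m → Good j)) →
      (1ℚ ℚ.- δ) ℚ.* ℕ→ℚ (σ ^ n) ℚ.≤ ℕ→ℚ (goodCount C σ n δ)
    some (m , large , below) = complement _ _ {c = tail σ n m} δ (good-or-tail m below)
      (ratio≤δ C δ {{m^n≢0 σ n {{>-nonZero (≤-trans (s≤s z≤n) 2≤σ)}}}} 0<δ (tail-bound m) large)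

theorem1 : (∃ λ (C : ℕ) → ∀ (σ n : ℕ) → 2 ≤ σ → 1 ≤ n →
    (σ * (n * σ ^ n ∸ totalL σ n) ≤ C * σ ^ n)
    × (σ * (totalL σ n ∸ n * σ ^ n) ≤ C * σ ^ n))
    × (∃ λ (C : ℕ) → ∀ (σ n : ℕ) (δ : ℚ) → 2 ≤ σ → 1 ≤ n → 0ℚ <ℚ δ →
    (1ℚ - δ) *ℚ ℕ→ℚ (σ ^ n) ≤ℚ ℕ→ℚ (goodCount C σ n δ))
theorem1 =
  -- 360 comes from the binary alphabet; larger alphabets have the constant 6.
  (360 , λ σ n 2≤σ _ →
    ≤-trans (*-monoʳ-≤ σ (expectation-lower σ n)) (totalDefect-bound σ n 2≤σ) ,
    ≤-trans (≤-reflexive (trans (cong (σ *_) (m≤n⇒m∸n≡0 (expectation-upper σ n))) (*-zeroʳ σ))) z≤n) ,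
  (258 , λ σ n δ 2≤σ _ 0<δ → concentration 258 σ n δ 2≤σ 0<δ (λ m → tail-decay σ n m 2≤σ))
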